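{- Let $Q$ be a reduced rooted tree poset and let $P$ be an inflation of $Q$ with map $\varphi:P\to Q$, and assume $|P|\ge 2$. Let $\ell_1,\dots,\ell_s$ be the leaves (minimal elements) of $Q$, and for each $i$ let $u_{i,0},\dots,u_{i,\omega(i)}$, $b_{i,j}$, $c_{i,j}$ be as defined in the context. Then the number of tangled labelings of $P$ is \[(n-1)!\sum_{i=1}^s\prod_{j=1}^{\omega(i)}\frac{b_{i,j}-1}{c_{i,j}-1},\] where $n=\sum_{v\in Q}|\varphi^{ -1}(v)|=|P|$.
   Context: A rooted tree poset is a finite connected poset in which each element is covered by at most one other element (so its Hasse diagram is a rooted tree whose root is the unique maximal element). It is reduced if no element covers exactly one element. An inflation of a finite poset $Q$ is a poset $P$ together with a surjective map $\varphi:P\to Q$ such that (1) for each $v\in Q$, the subposet $\varphi^{ -1}(v)$ has a unique minimal element, and (2) if $\varphi(x)\ne\varphi(y)$ then $x<_P y$ iff $\varphi(x)<_Q\varphi(y)$. For each leaf $\ell_i$ of $Q$, let $u_{i,0}=\ell_i,u_{i,1},\dots,u_{i,\omega(i)}$ be the path in the Hasse diagram from $\ell_i$ to the root, with $u_{i,j}$ covering $u_{i,j-1}$ and $u_{i,\omega(i)}$ the root. Define $b_{i,j}=\sum_{v\le_Q u_{i,j-1}}|\varphi^{ -1}(v)|$ and $c_{i,j}=\sum_{v<_Q u_{i,j}}|\varphi^{ -1}(v)|$. A labeling of an $n$-element poset $P$ is a bijection $L:P\to[n]$; a linear extension is a labeling with $L(x)\le L(y)$ whenever $x\le_P y$. For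 a labeling $L$ and a non-maximal $x$, the $L$-successor of $x$ is the element $y>_P x$ minimizing $L(y)$. The promotion chain of $L$ is $v_1<_P\cdots<_P v_m$ with $v_1=L^{ -1}(1)$, $v_{i+1}$ the $L$-successor of $v_i$ while $v_i$ is not maximal, and $v_m$ maximal. Extended promotion: $\partial(L)(x)=L(x)-1$ for $x$ not in the chain, $\partial(L)(v_i)=L(v_{i+1})-1$ for $i<m$, $\partial(L)(v_m)=n$. A labeling $L$ is tangled if $n\ge2$ and $\partial^{n-2}(L)$ is not a linear extension. An empty product equals $1$. -}

module Defs where

open import Level using (0ℓ)
open import Data.Bool using (Bool; true; false; if_then_else_)
open import Data.Nat as ℕ using (ℕ; zero; suc; _∸_)
open import Data.Fin as Fin using (Fin; toℕ; fromℕ)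
open import Data.Fin.Properties using (all?; any?)
open import Data.List using (List; []; _∷_; foldr; filter; length; map; concatMap; head)
open import Data.Nat.ListAction using (sum)
open import Data.Vec as Vec using (Vec; lookup)
open import Data.Maybe using (Maybe; just; nothing; maybe)
open import Data.Product using (Σ; ∃; _×_; _,_)
open import Data.Empty using (⊥)
open import Data.Integer using (+_)
open import Data.Rational as ℚ using (ℚ; 0ℚ; 1ℚ)
open import Relation.Nullary using (¬_; Dec; does)
open import Relation.Nullary.Decidable using (_×-dec_; _→-dec_; ¬?)
open import Relation.Binary using (IsDecPartialOrder)
open import Relation.Binary.PropositionalEquality using (_≡_; _≢_)
open import Relation.Binary.Construct.Closure.ReflexiveTransitive using (Star)
open import Data.Sum using (_⊎_)

record FinPoset (n : ℕ) : Set₁ where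
  field
    _≤_ : Fin n → Fin n → Set
    isDecPartialOrder : IsDecPartialOrder _≡_ _≤_

  _≤?_ : (x y : Fin n) → Dec (x ≤ y)
  _≤?_ = IsDecPartialOrder._≤?_ isDecPartialOrder

  _<_ : Fin n → Fin n → Set
  x < y = x ≤ y × x ≢ y

  _<?_ : (x y : Fin n) → Dec (x < y)
  x <? y = (x ≤? y) ×-dec ¬? (x Fin.≟ y)

  _⋖_ : Fin n → Fin n → Set
  x ⋖ y = x < y × (∀ z → x < z → z < y → ⊥)

  Minimal : Fin n → Set
  Minimal x = ∀ y → y ≤ x → y ≡ x

  Maximal : Fin n → Set
  Maximal x = ∀ y → x ≤ y → y ≡ x

  minimal? : (x : Fin n) → Dec (Minimal x)
  minimal? x = all? (λ y → (y ≤? x) →-dec (y Fin.≟ x))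



module _ {m : ℕ} (Q : FinPoset m) where
  open FinPoset Q

  Connected : Set
  Connected = ∀ x y → Star (λ a b → a ≤ b ⊎ b ≤ a) x y

  CoveredByAtMostOne : Set
  CoveredByAtMostOne = ∀ x y z → x ⋖ y → x ⋖ z → y ≡ z

  IsRootedTreePoset : Set
  IsRootedTreePoset = Connected × CoveredByAtMostOne

  IsReduced : Set
  IsReduced = ∀ y → ¬ (Σ (Fin m) λ x → x ⋖ y × (∀ x' → x' ⋖ y → x' ≡ x))

  HassePathToRoot : Fin m → List (Fin m) → Set
  HassePathToRoot x []       = Maximal x
  HassePathToRoot x (y ∷ ys) = x ⋖ y × HassePathToRoot y ys

  leaves : List (Fin m)
  leaves = filter minimal? (Data.List.allFin m)
    where import Data.List

module _ {n m : ℕ} (P : FinPoset n) (Q : FinPoset m) (φ : Fin n → Fin m) where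
  private
    module P = FinPoset P
    module Q = FinPoset Q

  MinimalInFiber : Fin m → Fin n → Set
  MinimalInFiber v x = φ x ≡ v × (∀ y → φ y ≡ v → y P.≤ x → y ≡ x)

  IsInflation : Set
  IsInflation =
    (∀ v → ∃ λ x → φ x ≡ v)
    × (∀ v → ∃ λ x → MinimalInFiber v x
                   × (∀ x' → MinimalInFiber v x' → x' ≡ x))
    × (∀ x y → φ x ≢ φ y →
         ((x P.< y → φ x Q.< φ y) × (φ x Q.< φ y → x P.< y)))

  fiberSize : Fin m → ℕ
  fiberSize v = length (filter (λ x → φ x Fin.≟ v) (Data.List.allFin n))
    where import Data.List

  sizeBelowEq : Fin m → ℕ
  sizeBelowEq u = sum (map fiberSize (filter (λ v → v Q.≤? u) (Data.List.allFin m)))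
    where import Data.List

  sizeBelow : Fin m → ℕ
  sizeBelow u = sum (map fiberSize (filter (λ v → v Q.<? u) (Data.List.allFin m)))
    where import Data.List

  -- a / d as a rational number (d ≠ 0 in all uses; convention a / 0 = 0)
  ratio : ℕ → ℕ → ℚ
  ratio a zero    = 0ℚ
  ratio a (suc d) = (+ a) ℚ./ suc d

  -- for a path u₀ = x, us = (u₁,…,u_ω):
  -- ∏_{j=1}^{ω} (b_j - 1)/(c_j - 1),  b_j = Σ_{v ≤ u_{j-1}} |φ⁻¹ v|,  c_j = Σ_{v < u_j} |φ⁻¹ v|
  pathProduct : Fin m → List (Fin m) → ℚ
  pathProduct x []       = 1ℚ
  pathProduct x (y ∷ ys) = ratio (sizeBelowEq x ∸ 1) (sizeBelow y ∸ 1) ℚ.* pathProduct y ys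

  leafSum : (Fin m → List (Fin m)) → ℚ
  leafSum path = foldr (λ ℓ acc → pathProduct ℓ (path ℓ) ℚ.+ acc) 0ℚ (leaves Q)

-- Labelings and extended promotion.
-- Labels [n] = {1,…,n} are represented by Fin n = {0,…,n-1} (label k ↔ k+1).

-- the largest label n (of Fin n, nonempty since it has an element)
topLabel : {n : ℕ} → Fin n → Fin n
topLabel {suc k} _ = fromℕ k

Labeling : ℕ → Set
Labeling n = Fin n → Fin n

module _ {n : ℕ} (P : FinPoset n) where
  open FinPoset P

  IsLabeling : Labeling n → Set
  IsLabeling L = (∀ x y → L x ≡ L y → x ≡ y) × (∀ k → ∃ λ x → L x ≡ k)

  IsLinearExtension : Labeling n → Set
  IsLinearExtension L = IsLabeling L × (∀ x y → x ≤ y → toℕ (L x) ℕ.≤ toℕ (L y))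

  successor : Labeling n → Fin n → Maybe (Fin n)
  successor L x = foldr step nothing (Data.List.allFin n)
    where
    import Data.List
    pick : Fin n → Maybe (Fin n) → Maybe (Fin n)
    pick y nothing  = just y
    pick y (just z) = if does (toℕ (L y) ℕ.<? toℕ (L z)) then just y else just z
    step : Fin n → Maybe (Fin n) → Maybe (Fin n)
    step y acc = if does (x <? y) then pick y acc else acc

  labelOne : Labeling n → Maybe (Fin n)
  labelOne L = head (filter (λ x → toℕ (L x) ℕ.≟ 0) (Data.List.allFin n))
    where import Data.List

  -- follow L-successors from x (with fuel; the chain has at most n elements)
  chainFrom : ℕ → Labeling n → Fin n → List (Fin n)
  chainFrom zero    L x = x ∷ []
  chainFrom (suc k) L x with successor L x
  ... | nothing = x ∷ []
  ... | just y  = x ∷ chainFrom k L y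

  promotionChain : Labeling n → List (Fin n)
  promotionChain L = maybe (chainFrom n L) [] (labelOne L)

  -- nothing: x not in chain; just (just y): y follows x in chain; just nothing: x is last
  nextIn : List (Fin n) → Fin n → Maybe (Maybe (Fin n))
  nextIn []       x = nothing
  nextIn (v ∷ vs) x = if does (v Fin.≟ x) then just (head vs) else nextIn vs x

  ∂ : Labeling n → Labeling n
  ∂ L x with nextIn (promotionChain L) x
  ... | nothing       = Fin.pred (L x)
  ... | just (just y) = Fin.pred (L y)
  ... | just nothing  = topLabel x

  ∂^ : ℕ → Labeling n → Labeling n
  ∂^ zero    L = L
  ∂^ (suc k) L = ∂ (∂^ k L)

  Tangled : Labeling n → Set
  Tangled L = 2 ℕ.≤ n × ¬ IsLinearExtension (∂^ (n ∸ 2) L)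

  isLabeling? : (L : Labeling n) → Dec (IsLabeling L)
  isLabeling? L = all? (λ x → all? (λ y → (L x Fin.≟ L y) →-dec (x Fin.≟ y)))
                  ×-dec all? (λ k → any? (λ x → L x Fin.≟ k))

  isLinearExtension? : (L : Labeling n) → Dec (IsLinearExtension L)
  isLinearExtension? L = isLabeling? L ×-dec
    all? (λ x → all? (λ y → (x ≤? y) →-dec (toℕ (L x) ℕ.≤? toℕ (L y))))

  tangled? : (L : Labeling n) → Dec (Tangled L)
  tangled? L = (2 ℕ.≤? n) ×-dec ¬? (isLinearExtension? (∂^ (n ∸ 2) L))

  -- all functions Fin n → Fin n, as vectors of values (each exactly once)
  allVecs : (k : ℕ) → List (Vec (Fin n) k)
  allVecs zero    = Vec.[] ∷ []
  allVecs (suc k) = concatMap (λ a → map (a Vec.∷_) (allVecs k)) (Data.List.allFin n)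
    where import Data.List

  numTangled : ℕ
  numTangled = length (filter (λ v → isLabeling? (lookup v) ×-dec tangled? (lookup v)) (allVecs n))

{-# OPTIONS --safe #-}

-- Read labels as tokens that move down the poset, each promotion removing the smallest token.
-- After n - 2 promotions only the two largest tokens are left to be sorted, and since
-- "L(x) < L(y) for all y > x" is preserved by promotion, L is tangled iff the largest label sits on
-- the bottom x₀ of the fiber of a leaf ℓ and the last but one token ends in that fiber.
-- For u above ℓ, let S be the set of elements over the vertices strictly below u. As the elements
-- outside S do not distinguish those of S, the tokens outside S evolve independently of the
-- arrangement inside. A token entering S lands in the branch of the token being removed and
-- inherits its ancestor, so the branch in which the last but one token ends is the one where its
-- ancestor was at the beginning. Transposing labels shows that the ancestor is uniformly
-- distributed on S without x₀, which gives the factors (b - 1) / (c - 1).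
module Submission where

open import Defs
open import Data.Bool using (if_then_else_)
open import Data.Fin as Fin using (Fin; toℕ; fromℕ; fromℕ<; punchOut)
import Data.Fin.Properties as Fin
open import Data.Fin.Induction using (po-wellFounded; po-noetherian)
open import Data.Fin.Permutation.Components using (transpose)
open import Data.Integer as ℤ using (+_)
import Data.Integer.Properties as ℤ
open import Data.List using (List; []; _∷_; _++_; length; filter; foldr; head; map;
  allFin; concatMap; cartesianProductWith)
open import Data.List.Membership.Propositional using (_∈_; find)
open import Data.List.Membership.Propositional.Properties
open import Data.List.Properties using (length-++; length-map; length-filter; length-tabulate; filter-++)
open import Data.List.Relation.Unary.All as All using (All; []; _∷_)
open import Data.List.Relation.Unary.AllPairs using ([]; _∷_)
open import Data.List.Relation.Unary.Any as Any using (Any; here; there)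
open import Data.List.Relation.Unary.Unique.Propositional using (Unique)
import Data.List.Relation.Unary.Unique.Propositional.Properties as Unique
open import Data.Maybe using (Maybe; just; nothing)
open import Data.Nat as ℕ using (ℕ; zero; suc; _+_; _∸_; _!; z≤n; s≤s)
open import Data.Nat.ListAction using (sum)
import Data.Nat.Properties as ℕ
open import Data.Product using (∃; _×_; _,_; proj₁; proj₂)
open import Data.Rational as ℚ using (fromℚᵘ; _/_)
import Data.Rational.Properties as ℚ
open import Data.Rational.Unnormalised as ℚᵘ using (mkℚᵘ; *≡*)
import Data.Rational.Unnormalised.Properties as ℚᵘ
open import Data.Sum using (_⊎_; inj₁; inj₂)
open import Data.Unit using (⊤; tt)
open import Data.Vec using (Vec; []; _∷_; lookup; tabulate)
open import Data.Vec.Properties using (lookup∘tabulate; tabulate∘lookup; tabulate-cong)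
open import Function using (id; flip; _∘_)
open import Induction.WellFounded using (WellFounded; Acc; acc)
open import Relation.Binary using (IsDecPartialOrder)
open import Relation.Binary.Construct.Closure.ReflexiveTransitive using (Star; ε; _◅_)
open import Relation.Binary.PropositionalEquality using (_≡_; _≢_; refl; sym; trans; cong; cong₂;
  subst; subst₂; module ≡-Reasoning)
open import Relation.Nullary using (¬_; Dec; yes; no; contradiction; does)
open import Relation.Nullary.Decidable using (_×-dec_; _→-dec_; ¬?; dec-true; dec-false)
open import Relation.Unary using (Decidable)

private variable
  A B C : Set

-- Counting

count : {P : A → Set} → Decidable P → List A → ℕ
count P? xs = length (filter P? xs)

count-cong : {P Q : A → Set} (P? : Decidable P) (Q? : Decidable Q) →
  (∀ a → P a → Q a) → (∀ a → Q a → P a) → ∀ xs → count P? xs ≡ count Q? xs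
count-cong P? Q? f g [] = refl
count-cong P? Q? f g (x ∷ xs) with P? x | Q? x
... | yes p | yes q = cong suc (count-cong P? Q? f g xs)
... | yes p | no ¬q = contradiction (f x p) ¬q
... | no ¬p | yes q = contradiction (g x q) ¬p
... | no ¬p | no ¬q = count-cong P? Q? f g xs

count-⊎ : {X P Q : A → Set} (X? : Decidable X) (P? : Decidable P) (Q? : Decidable Q) →
  (∀ a → X a → P a ⊎ Q a) → (∀ a → P a → X a) → (∀ a → Q a → X a) →
  (∀ a → P a → ¬ Q a) → ∀ xs → count X? xs ≡ count P? xs + count Q? xs
count-⊎ X? P? Q? split f g disjoint [] = refl
count-⊎ X? P? Q? split f g disjoint (x ∷ xs)
  with X? x | P? x | Q? x | count-⊎ X? P? Q? split f g disjoint xs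
... | yes _  | yes p | yes q | _  = contradiction q (disjoint x p)
... | yes _  | yes _ | no _  | ih = cong suc ih
... | yes _  | no _  | yes _ | ih = trans (cong suc ih) (sym (ℕ.+-suc _ _))
... | yes a  | no ¬p | no ¬q | _  with split x a
...   | inj₁ p = contradiction p ¬p
...   | inj₂ q = contradiction q ¬q
count-⊎ X? P? Q? split f g disjoint (x ∷ xs) | no ¬a | yes p | _     | _  = contradiction (f x p) ¬a
count-⊎ X? P? Q? split f g disjoint (x ∷ xs) | no ¬a | no _  | yes q | _  = contradiction (g x q) ¬a
count-⊎ X? P? Q? split f g disjoint (x ∷ xs) | no _  | no _  | no _  | ih = ih

count-none : {P : A → Set} (P? : Decidable P) → (∀ a → ¬ P a) → ∀ xs → count P? xs ≡ 0
count-none P? ¬P [] = refl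
count-none P? ¬P (x ∷ xs) with P? x
... | yes p = contradiction p (¬P x)
... | no _  = count-none P? ¬P xs

count-all : {P : A → Set} (P? : Decidable P) → (∀ a → P a) → ∀ xs → count P? xs ≡ length xs
count-all P? all [] = refl
count-all P? all (x ∷ xs) with P? x
... | yes p = cong suc (count-all P? all xs)
... | no ¬p = contradiction (all x) ¬p

any-in : {R : B → A → Set} → (∀ s → Decidable (R s)) → (ss : List B) →
  Decidable (λ a → Any (λ s → R s a) ss)
any-in R? ss a = Any.any? (λ s → R? s a) ss

-- Functionality of `R` makes the classes disjoint. This later splits labelings by leaf, labelings
-- by ancestor, and elements by fiber.
count-partition : {R : B → A → Set} (R? : ∀ s → Decidable (R s)) →
  (∀ s t a → R s a → R t a → s ≡ t) → (xs : List A) (ss : List B) → Unique ss →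
  count (any-in R? ss) xs ≡ sum (map (λ s → count (R? s) xs) ss)
count-partition R? functional xs [] _ = count-none (any-in R? []) (λ _ ()) xs
count-partition {R = R} R? functional xs (s ∷ ss) (s∉ ∷ u) =
  trans (count-⊎ (any-in R? (s ∷ ss)) (R? s) (any-in R? ss)
           split (λ _ → here) (λ _ → there) disjoint xs)
        (cong (λ k → count (R? s) xs + k) (count-partition R? functional xs ss u))
  where
  split : ∀ a → Any (λ t → R t a) (s ∷ ss) → R s a ⊎ Any (λ t → R t a) ss
  split a (here r)  = inj₁ r
  split a (there r) = inj₂ r
  absent : ∀ {ts a} → All (s ≢_) ts → R s a → ¬ Any (λ t → R t a) ts
  absent (s≢ ∷ _) r (here r′)  = s≢ (functional _ _ _ r r′)
  absent (_ ∷ s≢) r (there rs) = absent s≢ r rs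
  disjoint : ∀ a → R s a → ¬ Any (λ t → R t a) ss
  disjoint a = absent s∉

sum-const : (f : A → ℕ) (k : ℕ) → (xs : List A) → (∀ x → x ∈ xs → f x ≡ k) →
  sum (map f xs) ≡ length xs ℕ.* k
sum-const f k [] _ = refl
sum-const f k (x ∷ xs) h = cong₂ _+_ (h x (here refl)) (sum-const f k xs (λ y y∈ → h y (there y∈)))

Unique-⊆⇒length-≤ : (xs ys : List A) → Unique xs → (∀ a → a ∈ xs → a ∈ ys) → length xs ℕ.≤ length ys
Unique-⊆⇒length-≤ [] ys _ _ = z≤n
Unique-⊆⇒length-≤ (x ∷ xs) ys (x∉ ∷ u) sub with ∈-∃++ (sub x (here refl))
... | us , vs , refl = subst (suc (length xs) ℕ.≤_) (sym len)
        (s≤s (Unique-⊆⇒length-≤ xs (us ++ vs) u sub′))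
  where
  len : length (us ++ x ∷ vs) ≡ suc (length (us ++ vs))
  len = trans (length-++ us) (trans (ℕ.+-suc _ _) (cong suc (sym (length-++ us))))
  sub′ : ∀ a → a ∈ xs → a ∈ us ++ vs
  sub′ a a∈ with ∈-++⁻ us (sub a (there a∈))
  ... | inj₁ p           = ∈-++⁺ˡ p
  ... | inj₂ (here refl) = contradiction refl (All.lookup x∉ a∈)
  ... | inj₂ (there p)   = ∈-++⁺ʳ us p

count-injection : {P : A → Set} {Q : B → Set} (P? : Decidable P) (Q? : Decidable Q)
  (xs : List A) (ys : List B) → Unique xs → (∀ b → b ∈ ys) →
  (f : A → B) → (∀ a b → f a ≡ f b → a ≡ b) → (∀ a → P a → Q (f a)) →
  count P? xs ℕ.≤ count Q? ys
count-injection P? Q? xs ys u all f inj P⇒Q =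
  subst (ℕ._≤ count Q? ys) (length-map f (filter P? xs))
    (Unique-⊆⇒length-≤ (map f (filter P? xs)) (filter Q? ys)
      (Unique.map⁺ (inj _ _) (Unique.filter⁺ P? u)) sub)
  where
  sub : ∀ b → b ∈ map f (filter P? xs) → b ∈ filter Q? ys
  sub b b∈ with ∈-map⁻ f b∈
  ... | a , a∈ , refl = ∈-filter⁺ Q? (all b) (P⇒Q a (proj₂ (∈-filter⁻ P? {xs = xs} a∈)))

count-single : {P : A → Set} (P? : Decidable P) (xs : List A) → Unique xs →
  (x : A) → x ∈ xs → P x → (∀ y → P y → y ≡ x) → count P? xs ≡ 1
count-single P? xs u x x∈ px only = ℕ.≤-antisym
  (Unique-⊆⇒length-≤ (filter P? xs) (x ∷ []) (Unique.filter⁺ P? u)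
    (λ a a∈ → here (only a (proj₂ (∈-filter⁻ P? {xs = xs} a∈)))))
  (∈-length (∈-filter⁺ P? x∈ px))

concatMap-product : (f : A → B → C) → ∀ xs ys →
  concatMap (λ a → map (f a) ys) xs ≡ cartesianProductWith f xs ys
concatMap-product f []       ys = refl
concatMap-product f (x ∷ xs) ys = cong (map (f x) ys ++_) (concatMap-product f xs ys)

count-map : {X : B → Set} (X? : Decidable X) (f : A → B) → ∀ xs →
  count X? (map f xs) ≡ count (X? ∘ f) xs
count-map X? f [] = refl
count-map X? f (x ∷ xs) with X? (f x)
... | yes _ = cong suc (count-map X? f xs)
... | no _  = count-map X? f xs

count-concatMap : {X : C → Set} (X? : Decidable X) (f : A → B → C) → ∀ xs ys →
  count X? (concatMap (λ a → map (f a) ys) xs) ≡ sum (map (λ a → count (X? ∘ f a) ys) xs)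
count-concatMap X? f [] ys = refl
count-concatMap X? f (x ∷ xs) ys = trans (cong length (filter-++ X? (map (f x) ys) _))
  (trans (length-++ (filter X? (map (f x) ys)))
    (cong₂ _+_ (count-map X? (f x) ys) (count-concatMap X? f xs ys)))

sum-filter : {X : A → Set} (X? : Decidable X) (f : A → ℕ) (c : ℕ) → (∀ a → X a → f a ≡ c) →
  (∀ a → ¬ X a → f a ≡ 0) → ∀ xs → sum (map f xs) ≡ count X? xs ℕ.* c
sum-filter X? f c on off [] = refl
sum-filter X? f c on off (x ∷ xs) with X? x
... | yes p = cong₂ _+_ (on x p) (sum-filter X? f c on off xs)
... | no ¬p = cong₂ _+_ (off x ¬p) (sum-filter X? f c on off xs)

-- Finite functions and transpositions

injective⇒surjective : {n : ℕ} (f : Fin n → Fin n) → (∀ x y → f x ≡ f y → x ≡ y) → ∀ k → ∃ λ x → f x ≡ k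
injective⇒surjective {suc n} f inj k with Fin.any? (λ x → f x Fin.≟ k)
... | yes found = found
... | no ¬found = contradiction
        (Fin.injective⇒≤ {f = λ x → punchOut (avoids x)}
          (λ {x} {y} eq → inj x y (Fin.punchOut-injective (avoids x) (avoids y) eq)))
        ℕ.1+n≰n
  where
  avoids : ∀ x → k ≢ f x
  avoids x eq = ¬found (x , sym eq)

surjective⇒injective : {n : ℕ} (f : Fin n → Fin n) → (∀ k → ∃ λ x → f x ≡ k) → ∀ x y → f x ≡ f y → x ≡ y
surjective⇒injective f surj x y eq = trans (sym (g∘f x)) (trans (cong g eq) (g∘f y))
  where
  g : _ → _
  g k = proj₁ (surj k)
  f∘g : ∀ k → f (g k) ≡ k
  f∘g k = proj₂ (surj k)
  g∘f : ∀ z → g (f z) ≡ z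
  g∘f z with injective⇒surjective g (λ i j e → trans (sym (f∘g i)) (trans (cong f e) (f∘g j))) z
  ... | k , refl = cong g (f∘g k)

transpose-left : {n : ℕ} (i j : Fin n) → transpose i j i ≡ j
transpose-left i j rewrite dec-true (i Fin.≟ i) refl = refl

transpose-right : {n : ℕ} (i j : Fin n) → transpose i j j ≡ i
transpose-right i j with j Fin.≟ i
... | yes refl = refl
... | no _ rewrite dec-true (j Fin.≟ j) refl = refl

transpose-other : {n : ℕ} (i j k : Fin n) → k ≢ i → k ≢ j → transpose i j k ≡ k
transpose-other i j k k≢i k≢j
  rewrite dec-false (k Fin.≟ i) k≢i | dec-false (k Fin.≟ j) k≢j = refl

transpose-involutive : {n : ℕ} (i j k : Fin n) → transpose i j (transpose i j k) ≡ k
transpose-involutive i j k = go (k Fin.≟ i) (k Fin.≟ j)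
  where
  go : Dec (k ≡ i) → Dec (k ≡ j) → transpose i j (transpose i j k) ≡ k
  go (yes refl) _          = trans (cong (transpose i j) (transpose-left i j)) (transpose-right i j)
  go (no _)     (yes refl) = trans (cong (transpose i j) (transpose-right i j)) (transpose-left i j)
  go (no k≢i)   (no k≢j)   = trans (cong (transpose i j) other) other
    where other = transpose-other i j k k≢i k≢j

suc-pred : ∀ {k} (i : Fin k) → toℕ i ≢ 0 → suc (toℕ (Fin.pred i)) ≡ toℕ i
suc-pred Fin.zero    i≢0 = contradiction refl i≢0
suc-pred (Fin.suc i) _   = cong suc (Fin.toℕ-inject₁ i)

suc-topLabel : ∀ {k} (i : Fin k) → suc (toℕ (topLabel i)) ≡ k
suc-topLabel {suc k} i = cong suc (Fin.toℕ-fromℕ k)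

-- Rational numbers

fromℚᵘ-homo-* : ∀ p q → fromℚᵘ p ℚ.* fromℚᵘ q ≡ fromℚᵘ (p ℚᵘ.* q)
fromℚᵘ-homo-* p q = ℚ.toℚᵘ-injective (ℚᵘ.≃-trans (ℚ.toℚᵘ-homo-* (fromℚᵘ p) (fromℚᵘ q))
  (ℚᵘ.≃-trans (ℚᵘ.*-cong (ℚ.toℚᵘ-fromℚᵘ p) (ℚ.toℚᵘ-fromℚᵘ q)) (ℚᵘ.≃-sym (ℚ.toℚᵘ-fromℚᵘ (p ℚᵘ.* q)))))

fromℚᵘ-homo-+ : ∀ p q → fromℚᵘ p ℚ.+ fromℚᵘ q ≡ fromℚᵘ (p ℚᵘ.+ q)
fromℚᵘ-homo-+ p q = ℚ.toℚᵘ-injective (ℚᵘ.≃-trans (ℚ.toℚᵘ-homo-+ (fromℚᵘ p) (fromℚᵘ q))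
  (ℚᵘ.≃-trans (ℚᵘ.+-cong (ℚ.toℚᵘ-fromℚᵘ p) (ℚ.toℚᵘ-fromℚᵘ q)) (ℚᵘ.≃-sym (ℚ.toℚᵘ-fromℚᵘ (p ℚᵘ.+ q)))))

/1-homo-+ : ∀ a b → (+ (a + b)) ℚ./ 1 ≡ (+ a) ℚ./ 1 ℚ.+ (+ b) ℚ./ 1
/1-homo-+ a b = sym (trans (fromℚᵘ-homo-+ (mkℚᵘ (+ a) 0) (mkℚᵘ (+ b) 0))
  (cong (λ i → i ℚ./ 1) (cong₂ ℤ._+_ (ℤ.*-identityʳ (+ a)) (ℤ.*-identityʳ (+ b)))))

-- The counting is done in `ℕ` with cross-multiplied identities; here such an identity is turned
-- into a quotient.
/1-cross : ∀ a b c d → a ℕ.* suc c ≡ d ℕ.* b → (+ a) ℚ./ 1 ≡ (+ b) ℚ./ suc c ℚ.* ((+ d) ℚ./ 1)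
/1-cross a b c d eq = sym (trans (fromℚᵘ-homo-* (mkℚᵘ (+ b) c) (mkℚᵘ (+ d) 0))
  (ℚ.fromℚᵘ-cong {mkℚᵘ (+ b) c ℚᵘ.* mkℚᵘ (+ d) 0} {mkℚᵘ (+ a) 0} (*≡* (begin
    (+ b ℤ.* + d) ℤ.* + 1      ≡⟨ ℤ.*-identityʳ _ ⟩
    + b ℤ.* + d                ≡⟨ ℤ.pos-* b d ⟨
    + (b ℕ.* d)                ≡⟨ cong +_ (ℕ.*-comm b d) ⟩
    + (d ℕ.* b)                ≡⟨ cong +_ eq ⟨
    + (a ℕ.* suc c)            ≡⟨ cong (λ k → + (a ℕ.* k)) (ℕ.*-identityʳ (suc c)) ⟨
    + (a ℕ.* (suc c ℕ.* 1))    ≡⟨ ℤ.pos-* a (suc c ℕ.* 1) ⟩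
    + a ℤ.* + (suc c ℕ.* 1)    ∎))))
  where open ≡-Reasoning

-- Extended promotion

module Order {n : ℕ} (P : FinPoset n) where
  open FinPoset P public
  open IsDecPartialOrder isDecPartialOrder public
    using (isPartialOrder; antisym) renaming (refl to ≤-refl; trans to ≤-trans)

  <-≤-trans : ∀ {x y z} → x < y → y ≤ z → x < z
  <-≤-trans (x≤y , x≢y) y≤z = ≤-trans x≤y y≤z , λ { refl → x≢y (antisym x≤y y≤z) }

  ≤-<-trans : ∀ {x y z} → x ≤ y → y < z → x < z
  ≤-<-trans x≤y (y≤z , y≢z) = ≤-trans x≤y y≤z , λ { refl → y≢z (antisym y≤z x≤y) }

  <-trans : ∀ {x y z} → x < y → y < z → x < z
  <-trans x<y y<z = <-≤-trans x<y (proj₁ y<z)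

  ≤⇒<∨≡ : ∀ {x y} → x ≤ y → x < y ⊎ x ≡ y
  ≤⇒<∨≡ {x} {y} x≤y with x Fin.≟ y
  ... | yes eq = inj₂ eq
  ... | no neq = inj₁ (x≤y , neq)

  Top : Fin n → Set
  Top x = ∀ y → ¬ x < y

  <-noetherian : WellFounded (flip _<_)
  <-noetherian = po-noetherian isPartialOrder

  <-wellFounded : WellFounded _<_
  <-wellFounded = po-wellFounded isPartialOrder

  -- Decreases strictly along `<` and never exceeds `n`, which certifies that the fuel `n` of
  -- `promotionChain` suffices.
  #above : Fin n → ℕ
  #above x = count (x <?_) (allFin n)

  #above-< : ∀ {x y} → x < y → #above y ℕ.< #above x
  #above-< {x} {y} x<y =
    Unique-⊆⇒length-≤ (y ∷ filter (y <?_) (allFin n)) (filter (x <?_) (allFin n))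
      (All.tabulate (λ z∈ → proj₂ (proj₂ (∈-filter⁻ (y <?_) {xs = allFin n} z∈)))
        ∷ Unique.filter⁺ (y <?_) (Unique.allFin⁺ n))
      λ { a (here refl) → ∈-filter⁺ (x <?_) (∈-allFin a) x<y
        ; a (there a∈) → ∈-filter⁺ (x <?_) (∈-allFin a)
            (<-trans x<y (proj₂ (∈-filter⁻ (y <?_) {xs = allFin n} a∈))) }

  #above-≤ : ∀ x → #above x ℕ.≤ n
  #above-≤ x = subst (#above x ℕ.≤_) (length-tabulate id) (length-filter (x <?_) (allFin n))

module Promotion {n : ℕ} (P : FinPoset n) where
  open Order P

  Succ : Labeling n → Fin n → Fin n → Set
  Succ L x y = x < y × (∀ z → x < z → toℕ (L y) ℕ.≤ toℕ (L z))

  -- The promotion chain as an inductive predicate, without fuel or lists; `promotionChain-spec`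
  -- shows that it agrees with the computed list.
  data InChain (L : Labeling n) : Fin n → Set where
    start : ∀ {x} → toℕ (L x) ≡ 0 → InChain L x
    next  : ∀ {x y} → InChain L x → Succ L x y → InChain L y

  SuccSpec : Labeling n → Fin n → Maybe (Fin n) → List (Fin n) → Set
  SuccSpec L x nothing  zs = ∀ z → z ∈ zs → ¬ x < z
  SuccSpec L x (just y) zs = x < y × (∀ z → z ∈ zs → x < z → toℕ (L y) ℕ.≤ toℕ (L z))

  -- The helper functions of `successor` are local and cannot be named, so they are abstracted here
  -- by their defining equations, all of which hold by `refl` at the use.
  foldr-succ : (L : Labeling n) (x : Fin n) (step pick : Fin n → Maybe (Fin n) → Maybe (Fin n)) →
    (∀ y best → step y best ≡ (if does (x <? y) then pick y best else best)) →
    (∀ y → pick y nothing ≡ just y) →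
    (∀ y z → pick y (just z) ≡ (if does (toℕ (L y) ℕ.<? toℕ (L z)) then just y else just z)) →
    ∀ zs → SuccSpec L x (foldr step nothing zs) zs
  foldr-succ L x step pick step≡ pick₀ pick₁ [] = λ z ()
  foldr-succ L x step pick step≡ pick₀ pick₁ (y ∷ ys)
    rewrite step≡ y (foldr step nothing ys)
    with foldr step nothing ys | foldr-succ L x step pick step≡ pick₀ pick₁ ys | x <? y
  ... | nothing | ih | no x≮y rewrite dec-false (x <? y) x≮y =
    λ { z (here refl) → x≮y ; z (there z∈) → ih z z∈ }
  ... | just w | x<w , ih | no x≮y rewrite dec-false (x <? y) x≮y =
    x<w , λ { z (here refl) x<y → contradiction x<y x≮y ; z (there z∈) → ih z z∈ }
  ... | nothing | ih | yes x<y rewrite dec-true (x <? y) x<y | pick₀ y =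
    x<y , λ { z (here refl) _ → ℕ.≤-refl ; z (there z∈) x<z → contradiction x<z (ih z z∈) }
  ... | just w | x<w , ih | yes x<y rewrite dec-true (x <? y) x<y | pick₁ y w with toℕ (L y) ℕ.<? toℕ (L w)
  ...   | yes lt rewrite dec-true (toℕ (L y) ℕ.<? toℕ (L w)) lt =
    x<y , λ { z (here refl) _ → ℕ.≤-refl
            ; z (there z∈) x<z → ℕ.≤-trans (ℕ.<⇒≤ lt) (ih z z∈ x<z) }
  ...   | no ≮ rewrite dec-false (toℕ (L y) ℕ.<? toℕ (L w)) ≮ =
    x<w , λ { z (here refl) _ → ℕ.≮⇒≥ ≮ ; z (there z∈) → ih z z∈ }

  successor-spec : ∀ L x → SuccSpec L x (successor P L x) (allFin n)
  successor-spec L x =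
    foldr-succ L x _ _ (λ _ _ → refl) (λ _ → refl) (λ _ _ → refl) (allFin n)

  Succ-unique : ∀ {L} → IsLabeling P L → ∀ {x y z} → Succ L x y → Succ L x z → y ≡ z
  Succ-unique (inj , _) (x<y , minY) (x<z , minZ) =
    inj _ _ (Fin.toℕ-injective (ℕ.≤-antisym (minY _ x<z) (minZ _ x<y)))

  data Chain (L : Labeling n) : List (Fin n) → Set where
    last : ∀ {x} → Top x → Chain L (x ∷ [])
    cons : ∀ {x y vs} → Succ L x y → Chain L (y ∷ vs) → Chain L (x ∷ y ∷ vs)

  -- The fuel always bounds the number of elements above `x`; when it runs out, nothing is above
  -- `x`, so stopping there is correct.
  chainFrom-Chain : ∀ k L x → #above x ℕ.≤ k → ∃ λ vs → chainFrom P k L x ≡ x ∷ vs × Chain L (x ∷ vs)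
  chainFrom-Chain zero L x h =
    [] , refl , last (λ y x<y → ℕ.<⇒≱ (#above-< x<y) (ℕ.≤-trans h z≤n))
  chainFrom-Chain (suc k) L x h with successor P L x | successor-spec L x
  ... | nothing | none = [] , refl , last (λ y → none y (∈-allFin y))
  ... | just y | x<y , least with chainFrom P k L y
            | chainFrom-Chain k L y (ℕ.s≤s⁻¹ (ℕ.≤-trans (#above-< x<y) h))
  ...   | _ | vs , refl , c = y ∷ vs , refl , cons (x<y , λ z → least z (∈-allFin z)) c

  labelOne-spec : ∀ L → IsLabeling P L → Fin n → ∃ λ x → labelOne P L ≡ just x × toℕ (L x) ≡ 0
  labelOne-spec L (_ , surj) i with surj (fromℕ< (ℕ.≤-<-trans z≤n (Fin.toℕ<n i)))
  ... | z , Lz≡ = go (filter zero? (allFin n))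
          (∈-filter⁺ zero? (∈-allFin z) (trans (cong toℕ Lz≡) (Fin.toℕ-fromℕ< _)))
          (λ x∈ → proj₂ (∈-filter⁻ zero? {xs = allFin n} x∈))
    where
    zero? = λ x → toℕ (L x) ℕ.≟ 0
    go : ∀ xs → z ∈ xs → (∀ {x} → x ∈ xs → toℕ (L x) ≡ 0) → ∃ λ x → head xs ≡ just x × toℕ (L x) ≡ 0
    go (x ∷ _) _ allZero = x , refl , allZero (here refl)

  Chain-next : ∀ {L} → IsLabeling P L → ∀ {vs x y} → Chain L vs → x ∈ vs → Succ L x y → y ∈ vs
  Chain-next lab (last top) (here refl) (x<y , _) = contradiction x<y (top _)
  Chain-next lab (cons s c) (here refl) s′ = there (here (Succ-unique lab s′ s))
  Chain-next lab (cons s c) (there x∈) s′ = there (Chain-next lab c x∈ s′)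

  Chain⇒InChain : ∀ {L v vs} → Chain L (v ∷ vs) → InChain L v → ∀ {x} → x ∈ v ∷ vs → InChain L x
  Chain⇒InChain c p (here refl) = p
  Chain⇒InChain (cons s c) p (there x∈) = Chain⇒InChain c (next p s) x∈

  NextSpec : Labeling n → List (Fin n) → Fin n → Maybe (Maybe (Fin n)) → Set
  NextSpec L vs x nothing         = ¬ x ∈ vs
  NextSpec L vs x (just nothing)  = x ∈ vs × Top x
  NextSpec L vs x (just (just y)) = x ∈ vs × Succ L x y

  nextIn-spec : ∀ {L vs} → Chain L vs → ∀ x → NextSpec L vs x (nextIn P vs x)
  nextIn-spec (last {v} top) x with v Fin.≟ x
  ... | yes refl = here refl , top
  ... | no v≢x   = λ { (here refl) → v≢x refl }
  nextIn-spec (cons {v} {w} {vs} s c) x with v Fin.≟ x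
  ... | yes refl = here refl , s
  ... | no v≢x with nextIn P (w ∷ vs) x | nextIn-spec c x
  ...   | nothing       | x∉ = λ { (here refl) → v≢x refl ; (there x∈) → x∉ x∈ }
  ...   | just nothing  | x∈ , t = there x∈ , t
  ...   | just (just _) | x∈ , s′ = there x∈ , s′

  promotionChain-spec : ∀ L → IsLabeling P L → Fin n →
    Chain L (promotionChain P L) ×
    (∀ x → x ∈ promotionChain P L → InChain L x) × (∀ x → InChain L x → x ∈ promotionChain P L)
  promotionChain-spec L lab i with labelOne P L | labelOne-spec L lab i
  ... | _ | v , refl , Lv≡0 with chainFrom P n L v | chainFrom-Chain n L v (#above-≤ v)
  ...   | _ | vs , refl , c = c , (λ x → Chain⇒InChain c (start Lv≡0)) , to
    where
    to : ∀ x → InChain L x → x ∈ v ∷ vs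
    to x (start Lx≡0) = here (proj₁ lab x v (Fin.toℕ-injective (trans Lx≡0 (sym Lv≡0))))
    to x (next p s)   = Chain-next lab c (to _ p) s

  start-≤ : ∀ {L} → IsLabeling P L → ∀ {x y} → toℕ (L x) ≡ 0 → InChain L y → x ≤ y
  start-≤ lab Lx≡0 (start Ly≡0) with proj₁ lab _ _ (Fin.toℕ-injective (trans Lx≡0 (sym Ly≡0)))
  ... | refl = ≤-refl
  start-≤ lab Lx≡0 (next p (x<y , _)) = ≤-trans (start-≤ lab Lx≡0 p) (proj₁ x<y)

  -- The index is the new label of x plus one, i.e. the label that moves to x.
  data Step (L : Labeling n) (x : Fin n) : ℕ → Set where
    off : ¬ InChain L x → Step L x (toℕ (L x))
    mid : ∀ y → InChain L x → Succ L x y → Step L x (toℕ (L y))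
    end : InChain L x → Top x → Step L x n

  Succ-label≢0 : ∀ {L} → IsLabeling P L → ∀ {x y} → InChain L x → Succ L x y → toℕ (L y) ≢ 0
  Succ-label≢0 lab p ((x≤y , x≢y) , _) Ly≡0 = x≢y (antisym x≤y (start-≤ lab Ly≡0 p))

  -- `Fin.pred` fixes zero, so the index is right only if the label that moves is nonzero. Off the
  -- chain it is, since the position of 0 starts the chain; on the chain it is, since that position
  -- lies weakly below every chain element.
  step : ∀ L → IsLabeling P L → ∀ x → Step L x (suc (toℕ (∂ P L x)))
  step L lab x = go (nextIn P (promotionChain P L) x) refl (nextIn-spec chain x)
    where
    chain = proj₁ (promotionChain-spec L lab x)
    sound = proj₁ (proj₂ (promotionChain-spec L lab x))
    complete = proj₂ (proj₂ (promotionChain-spec L lab x))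
    go : ∀ r → nextIn P (promotionChain P L) x ≡ r → NextSpec L (promotionChain P L) x r →
      Step L x (suc (toℕ (∂ P L x)))
    go nothing eq x∉ = subst (Step L x) (sym val) (off (x∉ ∘ complete x))
      where
      val : suc (toℕ (∂ P L x)) ≡ toℕ (L x)
      val rewrite eq = suc-pred (L x) (x∉ ∘ complete x ∘ start)
    go (just nothing) eq (x∈ , top) = subst (Step L x) (sym val) (end (sound x x∈) top)
      where
      val : suc (toℕ (∂ P L x)) ≡ n
      val rewrite eq = suc-topLabel x
    go (just (just y)) eq (x∈ , s) = subst (Step L x) (sym val) (mid y (sound x x∈) s)
      where
      val : suc (toℕ (∂ P L x)) ≡ toℕ (L y)
      val rewrite eq = suc-pred (L y) (Succ-label≢0 lab (sound x x∈) s)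

  Top? : ∀ x → (∃ λ y → x < y) ⊎ Top x
  Top? x with Fin.any? (x <?_)
  ... | yes above = inj₁ above
  ... | no ¬above = inj₂ (λ y x<y → ¬above (y , x<y))

  ∃-Succ : ∀ L {x y} → x < y → ∃ (Succ L x)
  ∃-Succ L {x} {y} x<y with successor P L x | successor-spec L x
  ... | nothing | none        = contradiction x<y (none y (∈-allFin y))
  ... | just z  | x<z , least = z , x<z , λ w → least w (∈-allFin w)

  chain-end : ∀ {L x} → InChain L x → ∃ λ y → InChain L y × Top y
  chain-end {L} {x} = go (<-noetherian x)
    where
    go : ∀ {x} → Acc (flip _<_) x → InChain L x → ∃ λ y → InChain L y × Top y
    go {x} (acc rs) p with Top? x
    ... | inj₂ top = x , p , top
    ... | inj₁ (_ , x<y) with ∃-Succ L x<y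
    ...   | z , s = go (rs (proj₁ s)) (next p s)

  InChain-cases : ∀ {L x} → InChain L x → toℕ (L x) ≡ 0 ⊎ ∃ λ w → InChain L w × Succ L w x
  InChain-cases (start z)  = inj₁ z
  InChain-cases (next p s) = inj₂ (_ , p , s)

  -- The largest label goes to the end of the chain. For any other `k`, the element with label
  -- `k + 1` either is off the chain and keeps its token, or passes it to its predecessor in the
  -- chain.
  ∂-surjective : ∀ L → IsLabeling P L → ∀ k → ∃ λ x → ∂ P L x ≡ k
  ∂-surjective L lab@(_ , surj) k with suc (toℕ k) ℕ.<? n
  ... | no k+1≮n with chain-end (start (proj₂ (proj₂ (labelOne-spec L lab k))))
  ...   | x , p , top = x , Fin.toℕ-injective (ℕ.suc-injective (value (step L lab x)))
    where
    value : ∀ {l} → Step L x l → l ≡ suc (toℕ k)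
    value (off ¬p)           = contradiction p ¬p
    value (mid _ _ (x<y , _)) = contradiction x<y (top _)
    value (end _ _)          = ℕ.≤-antisym (ℕ.≮⇒≥ k+1≮n) (Fin.toℕ<n k)
  ∂-surjective L lab@(_ , surj) k | yes k+1<n = hit (step L lab z) refl
    where
    z = proj₁ (surj (fromℕ< k+1<n))
    Lz≡ : toℕ (L z) ≡ suc (toℕ k)
    Lz≡ = trans (cong toℕ (proj₂ (surj (fromℕ< k+1<n)))) (Fin.toℕ-fromℕ< k+1<n)
    below : InChain L z → ∃ λ x → ∂ P L x ≡ k
    below p with InChain-cases p
    ... | inj₁ Lz≡0 = contradiction (trans (sym Lz≡0) Lz≡) λ ()
    ... | inj₂ (w , q , s) = w , Fin.toℕ-injective (ℕ.suc-injective (value (step L lab w)))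
      where
      value : ∀ {l} → Step L w l → l ≡ suc (toℕ k)
      value (off ¬q)     = contradiction q ¬q
      value (end _ top)  = contradiction (proj₁ s) (top _)
      value (mid y _ s′) = trans (cong (toℕ ∘ L) (Succ-unique lab s′ s)) Lz≡
    hit : ∀ {l} → Step L z l → suc (toℕ (∂ P L z)) ≡ l → ∃ λ x → ∂ P L x ≡ k
    hit (off _) eq   = z , Fin.toℕ-injective (ℕ.suc-injective (trans eq Lz≡))
    hit (mid _ p _) _ = below p
    hit (end p _) _   = below p

  ∂-labeling : ∀ L → IsLabeling P L → IsLabeling P (∂ P L)
  ∂-labeling L lab = surjective⇒injective (∂ P L) (∂-surjective L lab) , ∂-surjective L lab

  ∂^-labeling : ∀ t L → IsLabeling P L → IsLabeling P (∂^ P t L)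
  ∂^-labeling zero    L lab = lab
  ∂^-labeling (suc t) L lab = ∂-labeling (∂^ P t L) (∂^-labeling t L lab)

  -- Tokens count labels from the first labeling: a token is a label plus the number of
  -- promotions done, so that it changes only by moving along the promotion chain.
  token : Labeling n → ℕ → Fin n → ℕ
  token L t x = toℕ (∂^ P t L x) + t

  token-injective : ∀ {L} → IsLabeling P L → ∀ t {x y} → token L t x ≡ token L t y → x ≡ y
  token-injective {L} lab t eq =
    proj₁ (∂^-labeling t L lab) _ _ (Fin.toℕ-injective (ℕ.+-cancelʳ-≡ t _ _ eq))

  token-< : ∀ L t x → token L t x ℕ.< n + t
  token-< L t x = ℕ.+-monoˡ-< t (Fin.toℕ<n (∂^ P t L x))

  token-suc : ∀ L t x → token L (suc t) x ≡ suc (toℕ (∂ P (∂^ P t L) x)) + t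
  token-suc L t x = ℕ.+-suc _ t

  -- A token that is at least `n` entered at a maximal element, as the largest so far. An element in
  -- the chain receives the least token above it, so such a token stays smaller than everything
  -- above. Hence only the tokens below `n` can still be out of order.
  frozen : ∀ {L} → IsLabeling P L → ∀ t {x y} → x < y → n ℕ.≤ token L t x → token L t x ℕ.< token L t y
  frozen {L} lab zero {x} _ n≤ =
    contradiction n≤ (ℕ.<⇒≱ (subst (ℕ._< n) (sym (ℕ.+-identityʳ _)) (Fin.toℕ<n (L x))))
  frozen {L} lab (suc t) {x} {y} x<y n≤ =
    subst₂ ℕ._<_ (sym (token-suc L t x)) (sym (token-suc L t y))
      (go (step _ labₜ x) (step _ labₜ y) (subst (n ℕ.≤_) (token-suc L t x) n≤))
    where
    labₜ = ∂^-labeling t L lab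
    go : ∀ {k l} → Step (∂^ P t L) x k → Step (∂^ P t L) y l → n ℕ.≤ k + t → k + t ℕ.< l + t
    go (end _ top) _ _ = contradiction x<y (top _)
    go (off _) (off _) n≤ = frozen lab t x<y n≤
    go (off _) (mid z _ (y<z , _)) n≤ = frozen lab t (<-trans x<y y<z) n≤
    go (off _) (end _ _) _ = token-< L t x
    go (mid w _ _) (end _ _) _ = token-< L t w
    go (mid w _ (_ , least)) (mid z _ (y<z , _)) n≤ =
      let w≤y = ℕ.+-monoˡ-≤ t (least y x<y) in
      ℕ.≤-<-trans w≤y (frozen lab t y<z (ℕ.≤-trans n≤ w≤y))
    go (mid w p s@(_ , least)) (off ¬q) _ =
      ℕ.≤∧≢⇒< (ℕ.+-monoˡ-≤ t (least y x<y))
        (λ e → ¬q (subst (InChain (∂^ P t L)) (token-injective lab t e) (next p s)))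

  -- Basins and minimal elements

  Basin : Labeling n → Fin n → Set
  Basin L x = ∀ y → x < y → toℕ (L x) ℕ.< toℕ (L y)

  zero-Basin : ∀ {L} → IsLabeling P L → ∀ {x} → toℕ (L x) ≡ 0 → Basin L x
  zero-Basin (inj , _) {x} Lx≡0 y (_ , x≢y) = ℕ.≤∧≢⇒< (subst (ℕ._≤ _) (sym Lx≡0) z≤n)
    (λ e → x≢y (inj _ _ (Fin.toℕ-injective e)))

  -- If `x` is in the chain it receives the least label above it, and `y` receives its own label,
  -- one from above it, or the largest. The comparison is made weakly; injectivity makes it strict.
  ∂-Basin : ∀ {L} → IsLabeling P L → ∀ {x} → Basin L x → Basin (∂ P L) x
  ∂-Basin {L} lab {x} basin y x<y =
    ℕ.≤∧≢⇒< (ℕ.s≤s⁻¹ (go (step L lab x) (step L lab y)))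
      (λ e → proj₂ x<y (proj₁ (∂-labeling L lab) _ _ (Fin.toℕ-injective e)))
    where
    go : ∀ {k l} → Step L x k → Step L y l → k ℕ.≤ l
    go (end _ top) _ = contradiction x<y (top _)
    go (off _) (off _) = ℕ.<⇒≤ (basin y x<y)
    go (off _) (mid z _ (y<z , _)) = ℕ.<⇒≤ (basin z (<-trans x<y y<z))
    go (off _) (end _ _) = ℕ.<⇒≤ (Fin.toℕ<n (L x))
    go (mid w _ (_ , least)) (off _) = least y x<y
    go (mid w _ (_ , least)) (mid z _ (y<z , _)) = least z (<-trans x<y y<z)
    go (mid w _ _) (end _ _) = ℕ.<⇒≤ (Fin.toℕ<n (L w))

  step-minimal : ∀ {L} → IsLabeling P L → ∀ {x} → Minimal x → toℕ (L x) ≢ 0 →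
    suc (toℕ (∂ P L x)) ≡ toℕ (L x)
  step-minimal {L} lab {x} xMin Lx≢0 = go (step L lab x)
    where
    outside : ¬ InChain L x
    outside (start z)                  = Lx≢0 z
    outside (next _ ((w≤x , w≢x) , _)) = w≢x (xMin _ w≤x)
    go : ∀ {k} → Step L x k → k ≡ toℕ (L x)
    go (off _)     = refl
    go (mid _ p _) = contradiction p outside
    go (end p _)   = contradiction p outside

  -- A minimal element enters the chain only when it carries label 0. Starting from the largest
  -- label, this does not happen before `n - 1` promotions are done.
  token-minimal : ∀ {L} → IsLabeling P L → ∀ {x} → Minimal x → suc (toℕ (L x)) ≡ n →
    ∀ t → suc t ℕ.≤ n → suc (token L t x) ≡ n
  token-minimal lab xMin top zero _ = trans (cong suc (ℕ.+-identityʳ _)) top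
  token-minimal {L} lab {x} xMin top (suc t) t+1<n =
    trans (cong suc (trans (token-suc L t x)
      (cong (_+ t) (step-minimal (∂^-labeling t L lab) xMin nonzero)))) ih
    where
    ih = token-minimal {L} lab {x} xMin top t (ℕ.<⇒≤ t+1<n)
    nonzero : toℕ (∂^ P t L x) ≢ 0
    nonzero z = ℕ.<-irrefl (trans (cong (λ k → suc (k + t)) (sym z)) ih) t+1<n

-- Labelings as vectors

module _ {n : ℕ} (P : FinPoset n) where

  allVecs-complete : ∀ {k} (v : Vec (Fin n) k) → v ∈ allVecs P k
  allVecs-complete []      = here refl
  allVecs-complete (a ∷ v) = ∈-concatMap⁺ (λ b → map (b ∷_) (allVecs P _))
    (Any.map (λ { refl → ∈-map⁺ (a ∷_) (allVecs-complete v) }) (∈-allFin a))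

  allVecs-unique : ∀ k → Unique (allVecs P k)
  allVecs-unique zero    = [] ∷ []
  allVecs-unique (suc k) = subst Unique (sym (concatMap-product _∷_ (allFin n) (allVecs P k)))
    (Unique.cartesianProductWith⁺ _∷_ (λ { refl → refl , refl })
      (Unique.allFin⁺ n) (allVecs-unique k))

  -- Injectivity of a vector phrased by recursion on its entries, with `D` the values already taken,
  -- so that labelings can be counted entry by entry.
  Fresh : ∀ {k} → List (Fin n) → Vec (Fin n) k → Set
  Fresh D []      = ⊤
  Fresh D (a ∷ v) = ¬ a ∈ D × Fresh (a ∷ D) v

  open import Data.List.Membership.DecPropositional (Fin._≟_ {n}) using (_∈?_)

  Fresh? : ∀ {k} D → Decidable (Fresh {k} D)
  Fresh? D []      = yes tt
  Fresh? D (a ∷ v) = ¬? (a ∈? D) ×-dec Fresh? (a ∷ D) v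

  Fresh⇒∉ : ∀ {k D} (v : Vec (Fin n) k) → Fresh D v → ∀ i → ¬ lookup v i ∈ D
  Fresh⇒∉ (a ∷ v) (a∉ , fr) Fin.zero    = a∉
  Fresh⇒∉ (a ∷ v) (a∉ , fr) (Fin.suc i) = Fresh⇒∉ v fr i ∘ there

  Fresh⇒injective : ∀ {k D} (v : Vec (Fin n) k) → Fresh D v → ∀ i j → lookup v i ≡ lookup v j → i ≡ j
  Fresh⇒injective (a ∷ v) fr       Fin.zero    Fin.zero    eq = refl
  Fresh⇒injective (a ∷ v) (_ , fr) Fin.zero    (Fin.suc j) eq = contradiction (here (sym eq)) (Fresh⇒∉ v fr j)
  Fresh⇒injective (a ∷ v) (_ , fr) (Fin.suc i) Fin.zero    eq = contradiction (here eq) (Fresh⇒∉ v fr i)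
  Fresh⇒injective (a ∷ v) (_ , fr) (Fin.suc i) (Fin.suc j) eq = cong Fin.suc (Fresh⇒injective v fr i j eq)

  injective⇒Fresh : ∀ {k D} (v : Vec (Fin n) k) → (∀ i → ¬ lookup v i ∈ D) →
    (∀ i j → lookup v i ≡ lookup v j → i ≡ j) → Fresh D v
  injective⇒Fresh [] _ _ = tt
  injective⇒Fresh (a ∷ v) ∉D inj = ∉D Fin.zero , injective⇒Fresh v
    (λ { i (here eq) → contradiction (inj (Fin.suc i) Fin.zero eq) λ ()
       ; i (there p) → ∉D (Fin.suc i) p })
    (λ i j eq → Fin.suc-injective (inj (Fin.suc i) (Fin.suc j) eq))

  count-∈ : ∀ D → Unique D → count (_∈? D) (allFin n) ≡ length D
  count-∈ D u = ℕ.≤-antisym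
    (Unique-⊆⇒length-≤ _ D (Unique.filter⁺ (_∈? D) (Unique.allFin⁺ n))
      (λ a a∈ → proj₂ (∈-filter⁻ (_∈? D) {xs = allFin n} a∈)))
    (Unique-⊆⇒length-≤ D _ u (λ a a∈ → ∈-filter⁺ (_∈? D) (∈-allFin a) a∈))

  count-∉ : ∀ D → Unique D → ∀ k → length D + k ≡ n → count (λ a → ¬? (a ∈? D)) (allFin n) ≡ k
  count-∉ D u k len = ℕ.+-cancelˡ-≡ (length D) _ _ (trans (sym split) (sym len))
    where
    dec : ∀ a → ⊤ → a ∈ D ⊎ ¬ a ∈ D
    dec a _ with a ∈? D
    ... | yes p = inj₁ p
    ... | no ¬p = inj₂ ¬p
    split : n ≡ length D + count (λ a → ¬? (a ∈? D)) (allFin n)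
    split = trans (sym (length-tabulate id))
      (trans (sym (count-all (λ _ → yes tt) (λ _ → tt) (allFin n)))
      (trans (count-⊎ (λ _ → yes tt) (_∈? D) (λ a → ¬? (a ∈? D)) dec (λ _ _ → tt) (λ _ _ → tt)
                (λ a p ¬p → ¬p p) (allFin n))
             (cong (_+ count (λ a → ¬? (a ∈? D)) (allFin n)) (count-∈ D u))))

  -- The first entry avoids `D` in `suc k` ways, and each choice leaves a vector of length `k`
  -- avoiding one more value.
  count-Fresh : ∀ k D → Unique D → length D + k ≡ n → count (Fresh? D) (allVecs P k) ≡ k !
  count-Fresh zero    D u len = refl
  count-Fresh (suc k) D u len = trans (count-concatMap (Fresh? D) _∷_ (allFin n) (allVecs P k))
    (trans (sum-filter (λ a → ¬? (a ∈? D)) _ (k !) fresh stale (allFin n))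
           (cong (ℕ._* k !) (count-∉ D u (suc k) len)))
    where
    fresh : ∀ a → ¬ a ∈ D → count (Fresh? D ∘ (a ∷_)) (allVecs P k) ≡ k !
    fresh a a∉ = trans
      (count-cong (Fresh? D ∘ (a ∷_)) (Fresh? (a ∷ D)) (λ _ → proj₂) (λ _ → a∉ ,_) (allVecs P k))
      (count-Fresh k (a ∷ D) (All.tabulate (λ { x∈ refl → a∉ x∈ }) ∷ u)
        (trans (sym (ℕ.+-suc _ k)) len))
    stale : ∀ a → ¬ ¬ a ∈ D → count (Fresh? D ∘ (a ∷_)) (allVecs P k) ≡ 0
    stale a ¬∉ = count-none (Fresh? D ∘ (a ∷_)) (λ v fr → ¬∉ (proj₁ fr)) (allVecs P k)

  -- Transposing two labels

  swap : Fin n → Fin n → Vec (Fin n) n → Vec (Fin n) n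
  swap i j v = tabulate (lookup v ∘ transpose i j)

  lookup-swap : ∀ i j v x → lookup (swap i j v) x ≡ lookup v (transpose i j x)
  lookup-swap i j v x = lookup∘tabulate _ x

  swap-injective : ∀ i j v w → swap i j v ≡ swap i j w → v ≡ w
  swap-injective i j v w eq = trans (sym (tabulate∘lookup v))
    (trans (tabulate-cong pointwise) (tabulate∘lookup w))
    where
    pointwise : ∀ x → lookup v x ≡ lookup w x
    pointwise x = trans (sym (back v)) (trans (cong (λ u → lookup u (transpose i j x)) eq) (back w))
      where
      back : ∀ u → lookup (swap i j u) (transpose i j x) ≡ lookup u x
      back u = trans (lookup-swap i j u _) (cong (lookup u) (transpose-involutive i j x))

  swap-labeling : ∀ i j v → IsLabeling P (lookup v) → IsLabeling P (lookup (swap i j v))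
  swap-labeling i j v (inj , surj) = inj′ , λ k → transpose i j (proj₁ (surj k)) ,
      trans (lookup-swap i j v _) (trans (cong (lookup v) (transpose-involutive i j _)) (proj₂ (surj k)))
    where
    inj′ : ∀ x y → lookup (swap i j v) x ≡ lookup (swap i j v) y → x ≡ y
    inj′ x y eq = trans (sym (transpose-involutive i j x)) (trans (cong (transpose i j)
      (inj _ _ (trans (sym (lookup-swap i j v x)) (trans eq (lookup-swap i j v y)))))
      (transpose-involutive i j y))

  count-swap : {X Y : Vec (Fin n) n → Set} (X? : Decidable X) (Y? : Decidable Y) → ∀ i j →
    (∀ v → X v → Y (swap i j v)) → count X? (allVecs P n) ℕ.≤ count Y? (allVecs P n)
  count-swap X? Y? i j X⇒Y = count-injection X? Y? _ _ (allVecs-unique n) allVecs-complete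
    (swap i j) (swap-injective i j) X⇒Y

  TopAt : Fin n → Vec (Fin n) n → Set
  TopAt x v = IsLabeling P (lookup v) × suc (toℕ (lookup v x)) ≡ n

  TopAt? : ∀ x → Decidable (TopAt x)
  TopAt? x v = isLabeling? P (lookup v) ×-dec (suc (toℕ (lookup v x)) ℕ.≟ n)

  TopAt-swap : ∀ x y v → TopAt x v → TopAt y (swap y x v)
  TopAt-swap x y v (lab , top) = swap-labeling y x v lab ,
    trans (cong (suc ∘ toℕ) (trans (lookup-swap y x v y) (cong (lookup v) (transpose-left y x)))) top

-- Transposition moves the largest label to position `Fin.zero`, the head of the vector. The head is
-- then forced and the tail is counted by `count-Fresh`.
count-TopAt : ∀ {m} (P : FinPoset (suc m)) x → count (TopAt? P x) (allVecs P (suc m)) ≡ m !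
count-TopAt {m} P x = trans
  (ℕ.≤-antisym (count-swap P (TopAt? P x) (TopAt? P Fin.zero) Fin.zero x (TopAt-swap P x Fin.zero))
               (count-swap P (TopAt? P Fin.zero) (TopAt? P x) x Fin.zero (TopAt-swap P Fin.zero x)))
  (trans (count-concatMap (TopAt? P Fin.zero) _∷_ (allFin (suc m)) (allVecs P m))
  (trans (sum-filter isTop? _ (m !) top notTop (allFin (suc m)))
  (trans (cong (ℕ._* m !) (count-single isTop? (allFin (suc m)) (Unique.allFin⁺ (suc m)) (fromℕ m) (∈-allFin _)
            (cong suc (Fin.toℕ-fromℕ m))
            λ y e → Fin.toℕ-injective (ℕ.suc-injective (trans e (cong suc (sym (Fin.toℕ-fromℕ m)))))))
         (ℕ.*-identityˡ (m !)))))
  where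
  isTop? : Decidable (λ (a : Fin (suc m)) → suc (toℕ a) ≡ suc m)
  isTop? a = suc (toℕ a) ℕ.≟ suc m
  top : ∀ a → suc (toℕ a) ≡ suc m → count (TopAt? P Fin.zero ∘ (a ∷_)) (allVecs P m) ≡ m !
  top a a≡ = trans
    (count-cong (TopAt? P Fin.zero ∘ (a ∷_)) (Fresh? P (a ∷ []))
      (λ v → λ { ((inj , _) , _) → proj₂ (injective⇒Fresh P {D = []} (a ∷ v) (λ _ ()) inj) })
      (λ v fr → let inj = Fresh⇒injective P {D = []} (a ∷ v) ((λ ()) , fr) in
                (inj , injective⇒surjective _ inj) , a≡)
      (allVecs P m))
    (count-Fresh P m (a ∷ []) ([] ∷ []) refl)
  notTop : ∀ a → ¬ suc (toℕ a) ≡ suc m → count (TopAt? P Fin.zero ∘ (a ∷_)) (allVecs P m) ≡ 0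
  notTop a a≢ = count-none (TopAt? P Fin.zero ∘ (a ∷_)) (λ v t → a≢ (proj₂ t)) (allVecs P m)

-- Autonomy outside a homogeneous down-set

-- With the size written as `suc (suc N)`, the number `n ∸ 2` of promotions reduces to `N`.
module Ends {N : ℕ} (P : FinPoset (suc (suc N))) where
  private
    n = suc (suc N)
  open Order P
  open Promotion P

  -- After `N` promotions the label 0 is the token `N`, the last but one of the original tokens.
  EndsIn : (Fin n → Set) → Labeling n → Set
  EndsIn B L = ∃ λ x → toℕ (∂^ P N L x) ≡ 0 × B x

  TopEnds : Fin n → (Fin n → Set) → Vec (Fin n) n → Set
  TopEnds x₀ B v = TopAt P x₀ v × EndsIn B (lookup v)

  TopEnds? : ∀ x₀ {B} → Decidable B → Decidable (TopEnds x₀ B)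
  TopEnds? x₀ B? v = TopAt? P x₀ v ×-dec Fin.any? (λ x → (toℕ (∂^ P N (lookup v) x) ℕ.≟ 0) ×-dec B? x)

  #TopEnds : Fin n → {B : Fin n → Set} → Decidable B → ℕ
  #TopEnds x₀ B? = count (TopEnds? x₀ B?) (allVecs P n)

  #without : Fin n → {B : Fin n → Set} → Decidable B → ℕ
  #without x₀ B? = count (λ x → B? x ×-dec ¬? (x Fin.≟ x₀)) (allFin n)

  -- By `T-comparable`, `T` meets `S` in a union of connected components of `S`. In the application
  -- `S` lies over the vertices strictly below a vertex `u`, and `T` over one branch below `u`.
  module Autonomy
    (S T : Fin n → Set) (S? : Decidable S)
    (S-down : ∀ {x y} → y ≤ x → S x → S y)
    (S-homogeneous : ∀ {s s′ y} → S s → S s′ → ¬ S y → s < y → s′ < y)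
    (S-exit : ∀ {s} → S s → ∃ λ y → s < y × ¬ S y)
    (T-comparable : ∀ {x y} → x ≤ y → S x → S y → (T x → T y) × (T y → T x))
    where

    Agree : Labeling n → Labeling n → Set
    Agree L L′ = ∀ x → ¬ S x → L x ≡ L′ x

    Agree-sym : ∀ {L L′} → Agree L L′ → Agree L′ L
    Agree-sym agree x ¬Sx = sym (agree x ¬Sx)

    chain-start : ∀ {L} → IsLabeling P L → Fin n → ∃ λ z → toℕ (L z) ≡ 0
    chain-start {L} lab x = proj₁ (labelOne-spec L lab x) , proj₂ (proj₂ (labelOne-spec L lab x))

    chain-exit : ∀ {L v} → InChain L v → S v →
      ∃ λ w → ∃ λ y → InChain L w × S w × ¬ S y × Succ L w y
    chain-exit {L} {v} = go (<-noetherian v)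
      where
      go : ∀ {v} → Acc (flip _<_) v → InChain L v → S v →
        ∃ λ w → ∃ λ y → InChain L w × S w × ¬ S y × Succ L w y
      go {v} (acc rs) p Sv with ∃-Succ L (proj₁ (proj₂ (S-exit Sv)))
      ... | y , s with S? y
      ...   | yes Sy = go (rs (proj₁ s)) (next p s) Sy
      ...   | no ¬Sy = v , y , p , Sv , ¬Sy , s

    Succ-agree : ∀ {L L′} → Agree L L′ → ∀ {x y} → ¬ S x → Succ L x y → Succ L′ x y
    Succ-agree agree ¬Sx (x<y , least) = x<y , λ z x<z →
      subst₂ ℕ._≤_ (cong toℕ (agree _ (above x<y))) (cong toℕ (agree z (above x<z))) (least z x<z)
      where
      above : ∀ {z} → _ < z → ¬ S z
      above x<z Sz = ¬Sx (S-down (proj₁ x<z) Sz)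

    -- By homogeneity every element of `S` sees the same elements outside `S`, and the exit is the
    -- one of these with the least label.
    exit-unique : ∀ {L L′} → IsLabeling P L → Agree L L′ → ∀ {v v′ y y′} →
      S v → ¬ S y → Succ L v y → S v′ → ¬ S y′ → Succ L′ v′ y′ → y ≡ y′
    exit-unique (inj , _) agree {y = y} {y′} Sv ¬Sy (v<y , least) Sv′ ¬Sy′ (v′<y′ , least′) =
      inj _ _ (Fin.toℕ-injective (ℕ.≤-antisym
        (least y′ (S-homogeneous Sv′ Sv ¬Sy′ v′<y′))
        (subst₂ ℕ._≤_ (cong toℕ (sym (agree y′ ¬Sy′))) (cong toℕ (sym (agree y ¬Sy)))
          (least′ y (S-homogeneous Sv Sv′ ¬Sy v<y)))))

    -- The only difficulty is a chain passing through `S`. Then label 0 lies in `S` for `L`; it does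
    -- so for `L′` too, since outside `S` the labelings agree. Both chains therefore leave `S`, and
    -- by `exit-unique` at the same element.
    InChain-agree : ∀ {L L′} → IsLabeling P L → IsLabeling P L′ → Agree L L′ →
      ∀ {x} → ¬ S x → InChain L x → InChain L′ x
    InChain-agree lab lab′ agree ¬Sx (start Lx≡0) = start (trans (cong toℕ (sym (agree _ ¬Sx))) Lx≡0)
    InChain-agree {L} {L′} lab lab′ agree {x} ¬Sx (next {w} p s) with S? w
    ... | no ¬Sw = next (InChain-agree lab lab′ agree ¬Sw p) (Succ-agree agree ¬Sw s)
    ... | yes Sw with chain-start lab x | chain-start lab′ x
    ...   | z , Lz≡0 | z′ , L′z′≡0 with S? z′
    ...     | no ¬Sz′ = contradiction
                (subst S (proj₁ lab _ _ (Fin.toℕ-injective (trans Lz≡0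
                  (sym (trans (cong toℕ (agree z′ ¬Sz′)) L′z′≡0))))) (S-down (start-≤ lab Lz≡0 p) Sw))
                ¬Sz′
    ...     | yes Sz′ with chain-exit (start L′z′≡0) Sz′
    ...       | v′ , y′ , p′ , Sv′ , ¬Sy′ , s′ with exit-unique lab agree Sw ¬Sx s Sv′ ¬Sy′ s′
    ...         | refl = next p′ s′

    ∂-agree : ∀ {L L′} → IsLabeling P L → IsLabeling P L′ → Agree L L′ → Agree (∂ P L) (∂ P L′)
    ∂-agree {L} {L′} lab lab′ agree x ¬Sx =
      Fin.toℕ-injective (ℕ.suc-injective (go (step L lab x) (step L′ lab′ x)))
      where
      to = InChain-agree lab lab′ agree ¬Sx
      from = InChain-agree lab′ lab (Agree-sym agree) ¬Sx
      go : ∀ {k l} → Step L x k → Step L′ x l → k ≡ l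
      go (off _)     (off _)     = cong toℕ (agree x ¬Sx)
      go (off ¬p)    (mid _ q _) = contradiction (from q) ¬p
      go (off ¬p)    (end q _)   = contradiction (from q) ¬p
      go (mid _ p _) (off ¬q)    = contradiction (to p) ¬q
      go (end p _)   (off ¬q)    = contradiction (to p) ¬q
      go (mid _ _ (x<y , _)) (end _ top) = contradiction x<y (top _)
      go (end _ top) (mid _ _ (x<y , _)) = contradiction x<y (top _)
      go (end _ _)   (end _ _)   = refl
      go (mid y _ s@(x<y , _)) (mid y′ _ s′) = trans
        (cong toℕ (agree y (λ Sy → ¬Sx (S-down (proj₁ x<y) Sy))))
        (cong (toℕ ∘ L′) (Succ-unique lab′ (Succ-agree agree ¬Sx s) s′))

    ∂^-agree : ∀ {L L′} → IsLabeling P L → IsLabeling P L′ → Agree L L′ →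
      ∀ t → Agree (∂^ P t L) (∂^ P t L′)
    ∂^-agree lab lab′ agree zero    = agree
    ∂^-agree lab lab′ agree (suc t) =
      ∂-agree (∂^-labeling t _ lab) (∂^-labeling t _ lab′) (∂^-agree lab lab′ agree t)

    -- A label moving to x ∈ S either comes from some z ∈ S, or enters S from outside; in the
    -- latter case it is charged to the position z of the label 0 that is removed from S.
    Source : Labeling n → Fin n → ℕ → Set
    Source L z k = toℕ (L z) ≡ k ⊎ toℕ (L z) ≡ 0 × ∃ λ y → ¬ S y × toℕ (L y) ≡ k

    Origin : Fin n → Fin n → Set
    Origin x z = S z × (T x → T z) × (T z → T x)

    -- A chain element lies weakly above the position of label 0, so charging a token from outside
    -- to that position stays in the same component of `S`.
    source : ∀ {L} → IsLabeling P L → ∀ x → S x →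
      ∃ λ z → Origin x z × Source L z (suc (toℕ (∂ P L x)))
    source {L} lab x Sx = go (step L lab x)
      where
      go : ∀ {k} → Step L x k → ∃ λ z → Origin x z × Source L z k
      go (off _) = x , (Sx , (λ t → t) , (λ t → t)) , inj₁ refl
      go (end _ top) = contradiction (proj₁ (proj₂ (S-exit Sx))) (top _)
      go (mid y p ((x≤y , _) , _)) with S? y
      ... | yes Sy = y , (Sy , T-comparable x≤y Sx Sy) , inj₁ refl
      ... | no ¬Sy with chain-start lab x
      ...   | z , Lz≡0 = z , (Sz , proj₂ same , proj₁ same) , inj₂ (Lz≡0 , y , ¬Sy , refl)
        where
        z≤x = start-≤ lab Lz≡0 p
        Sz = S-down z≤x Sx
        same = T-comparable z≤x Sz Sx

    origin : ∀ {L} → IsLabeling P L → ∀ (t : ℕ) x → S x → ∃ (Origin x)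
    origin lab zero x Sx = x , Sx , (λ t → t) , (λ t → t)
    origin lab (suc t) x Sx with source (∂^-labeling t _ lab) x Sx
    ... | y , (Sy , to , from) , _ with origin lab t y Sy
    ...   | z , Sz , to′ , from′ = z , Sz , to′ ∘ to , from ∘ from′

    -- Traced back one promotion, equal labels have sources with equal labels: both the moving
    -- label, or both 0. In a mixed case the moving label would lie outside `S` for one labeling,
    -- hence for both, and also inside `S` for the other.
    origin-agree : ∀ {L L′} (lab : IsLabeling P L) (lab′ : IsLabeling P L′) → Agree L L′ →
      ∀ t {x x′} (Sx : S x) (Sx′ : S x′) → ∂^ P t L x ≡ ∂^ P t L′ x′ →
      L (proj₁ (origin lab t x Sx)) ≡ L′ (proj₁ (origin lab′ t x′ Sx′))
    origin-agree lab lab′ agree zero Sx Sx′ eq = eq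
    origin-agree {L} {L′} lab lab′ agree (suc t) {x} {x′} Sx Sx′ eq
      with source (∂^-labeling t _ lab) x Sx | source (∂^-labeling t _ lab′) x′ Sx′
    ... | y , (Sy , _) , src | y′ , (Sy′ , _) , src′ =
      origin-agree lab lab′ agree t Sy Sy′ (Fin.toℕ-injective (go src src′))
      where
      suc-eq = cong (suc ∘ toℕ) eq
      go : Source (∂^ P t L) y _ → Source (∂^ P t L′) y′ _ → toℕ (∂^ P t L y) ≡ toℕ (∂^ P t L′ y′)
      go (inj₁ e) (inj₁ e′) = trans e (trans suc-eq (sym e′))
      go (inj₂ (z , _)) (inj₂ (z′ , _)) = trans z (sym z′)
      go (inj₁ e) (inj₂ (_ , w , ¬Sw , e′)) = contradiction
        (subst S (proj₁ (∂^-labeling t L lab) y w (Fin.toℕ-injective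
          (trans e (trans suc-eq (trans (sym e′) (cong toℕ (sym (∂^-agree lab lab′ agree t w ¬Sw)))))))) Sy)
        ¬Sw
      go (inj₂ (_ , w , ¬Sw , e)) (inj₁ e′) = contradiction
        (subst S (proj₁ (∂^-labeling t L′ lab′) y′ w (Fin.toℕ-injective
          (trans e′ (trans (sym suc-eq) (trans (sym e) (cong toℕ (∂^-agree lab lab′ agree t w ¬Sw))))))) Sy′)
        ¬Sw

    -- Within the allowed time `x₀` never carries label 0, so no entering token is charged to it.
    -- The only token tracing back to `x₀` is the largest original one, which has not moved.
    origin-minimal : ∀ {L} (lab : IsLabeling P L) {x₀} → Minimal x₀ → suc (toℕ (L x₀)) ≡ n →
      ∀ t → suc t ℕ.≤ n → ∀ {x} (Sx : S x) → proj₁ (origin lab t x Sx) ≡ x₀ → x ≡ x₀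
    origin-minimal lab x₀Min top zero _ Sx eq = eq
    origin-minimal {L} lab {x₀} x₀Min top (suc t) t<n {x} Sx eq
      with source (∂^-labeling t _ lab) x Sx
    ... | y , (Sy , _) , src with origin-minimal lab x₀Min top t (ℕ.<⇒≤ t<n) Sy eq
    ...   | refl = go src
      where
      last-token : suc (token L t x₀) ≡ n
      last-token = token-minimal lab x₀Min top t (ℕ.<⇒≤ t<n)
      go : Source (∂^ P t L) x₀ (suc (toℕ (∂^ P (suc t) L x))) → x ≡ x₀
      go (inj₂ (z , _)) = contradiction t<n
        (ℕ.<-irrefl (trans (cong (λ k → suc (k + t)) (sym z)) last-token))
      go (inj₁ e) = token-injective lab (suc t) (trans (token-suc L t x)
        (trans (cong (_+ t) (sym e)) (ℕ.suc-injective
          (trans last-token (sym (token-minimal lab x₀Min top (suc t) t<n))))))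

    -- The original tokens are those below n. They are smaller than the new ones, so that a hole
    -- in S is filled by an original token as long as one is left above S.
    originals-above : ∀ {L} → IsLabeling P L → ∀ t {s y} → S s → ¬ S y → s < y → token L t y ℕ.< n →
      ∀ s′ → S s′ → token L t s′ ℕ.< n
    originals-above {L} lab zero _ _ _ _ s′ _ =
      subst (ℕ._< n) (sym (ℕ.+-identityʳ _)) (Fin.toℕ<n (L s′))
    originals-above {L} lab (suc t) {s} {y} Ss ¬Sy s<y y<n s′ Ss′ =
      above (step _ labₜ y) (subst (ℕ._< n) (token-suc L t y) y<n)
      where
      labₜ = ∂^-labeling t L lab
      inside : ∀ {y} → ¬ S y → s < y → token L t y ℕ.< n → ∀ {k} → Step (∂^ P t L) s′ k → k + t ℕ.< n
      inside ¬Sy s<y y<n (off _) = originals-above lab t Ss ¬Sy s<y y<n s′ Ss′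
      inside ¬Sy s<y y<n (end _ top) = contradiction (proj₁ (proj₂ (S-exit Ss′))) (top _)
      inside ¬Sy s<y y<n (mid z _ (_ , least)) =
        ℕ.≤-<-trans (ℕ.+-monoˡ-≤ t (least _ (S-homogeneous Ss Ss′ ¬Sy s<y))) y<n
      conclude : ∀ {y} → ¬ S y → s < y → token L t y ℕ.< n → token L (suc t) s′ ℕ.< n
      conclude ¬Sy s<y y<n =
        subst (ℕ._< n) (sym (token-suc L t s′)) (inside ¬Sy s<y y<n (step _ labₜ s′))
      above : ∀ {k} → Step (∂^ P t L) y k → k + t ℕ.< n → token L (suc t) s′ ℕ.< n
      above (off _) lt = conclude ¬Sy s<y lt
      above (mid z _ (y<z , _)) lt =
        conclude (λ Sz → ¬Sy (S-down (proj₁ y<z) Sz)) (<-trans s<y y<z) lt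
      above (end _ _) lt = contradiction lt (ℕ.≤⇒≯ (ℕ.m≤m+n n t))

    -- Equidistribution of the ancestor

    module Ratio (T? : Decidable T) (T⇒S : ∀ {x} → T x → S x) (x₀ : Fin n) (x₀Min : Minimal x₀) where

      ancestor : (v : Vec (Fin n) n) → TopEnds x₀ S v → Fin n
      ancestor v ((lab , _) , q , _ , Sq) = proj₁ (origin lab N q Sq)

      ancestor-agree : (v w : Vec (Fin n) n) (h : TopEnds x₀ S v) (h′ : TopEnds x₀ S w) →
        Agree (lookup v) (lookup w) → lookup v (ancestor v h) ≡ lookup w (ancestor w h′)
      ancestor-agree v w ((lab , _) , q , q≡0 , Sq) ((lab′ , _) , q′ , q′≡0 , Sq′) agree =
        origin-agree lab lab′ agree N Sq Sq′ (Fin.toℕ-injective (trans q≡0 (sym q′≡0)))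

      -- `ancestor` is computed from the proof `h`. Comparing `v` with itself shows that its value
      -- depends on `v` alone, as deciding and counting by ancestor requires.
      ancestor-irrelevant : (v : Vec (Fin n) n) (h h′ : TopEnds x₀ S v) → ancestor v h ≡ ancestor v h′
      ancestor-irrelevant v h h′ = proj₁ (proj₁ (proj₁ h)) _ _ (ancestor-agree v v h h′ (λ _ _ → refl))

      Ancestor : Fin n → Vec (Fin n) n → Set
      Ancestor s v = ∃ λ (h : TopEnds x₀ S v) → ancestor v h ≡ s

      Ancestor? : ∀ s → Decidable (Ancestor s)
      Ancestor? s v with TopEnds? x₀ S? v
      ... | no ¬h = no (¬h ∘ proj₁)
      ... | yes h with ancestor v h Fin.≟ s
      ...   | yes eq = yes (h , eq)
      ...   | no neq = no (λ { (h′ , eq) → neq (trans (ancestor-irrelevant v h h′) eq) })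

      Ancestor-functional : ∀ s t v → Ancestor s v → Ancestor t v → s ≡ t
      Ancestor-functional s t v (h , eq) (h′ , eq′) = trans (sym eq) (trans (ancestor-irrelevant v h h′) eq′)

      swap-agree : ∀ {s t} → S s → S t → ∀ v → Agree (lookup v) (lookup (swap P s t v))
      swap-agree {s} {t} Ss St v x ¬Sx = sym (trans (lookup-swap P s t v x)
        (cong (lookup v) (transpose-other s t x (λ { refl → ¬Sx Ss }) (λ { refl → ¬Sx St }))))

      -- Transposing inside `S` changes nothing outside `S`, now or later, so the token `N` still
      -- ends in `S`. Its ancestor keeps its initial label by `ancestor-agree`, and that label has
      -- moved from `s` to `t`.
      Ancestor-swap : ∀ {s t} → S s → s ≢ x₀ → S t → t ≢ x₀ → ∀ v → Ancestor s v → Ancestor t (swap P s t v)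
      Ancestor-swap {s} {t} Ss s≢ St t≢ v (h@((lab , top) , q , q≡0 , Sq) , anc≡s) = h′ , eq
        where
        agree = swap-agree Ss St v
        lab′ = swap-labeling P s t v lab
        q′ = proj₁ (chain-start (∂^-labeling N _ lab′) q)
        q′≡0 = proj₂ (chain-start (∂^-labeling N _ lab′) q)
        Sq′ : S q′
        Sq′ with S? q′
        ... | yes p = p
        ... | no ¬p = contradiction (subst S (proj₁ (∂^-labeling N _ lab) q q′ (Fin.toℕ-injective
                (trans q≡0 (sym (trans (cong toℕ (∂^-agree lab lab′ agree N q′ ¬p)) q′≡0))))) Sq) ¬p
        h′ : TopEnds x₀ S (swap P s t v)
        h′ = (lab′ , trans (cong (suc ∘ toℕ) (trans (lookup-swap P s t v x₀)
                (cong (lookup v) (transpose-other s t x₀ (s≢ ∘ sym) (t≢ ∘ sym))))) top) , q′ , q′≡0 , Sq′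
        z′ = ancestor (swap P s t v) h′
        s≡ : transpose s t z′ ≡ s
        s≡ = trans (sym (proj₁ lab _ _
          (trans (ancestor-agree v (swap P s t v) h h′ agree) (lookup-swap P s t v z′)))) anc≡s
        eq : z′ ≡ t
        eq = trans (sym (transpose-involutive s t z′))
          (trans (cong (transpose s t) s≡) (transpose-left s t))

      #Ancestor : Fin n → ℕ
      #Ancestor s = count (Ancestor? s) (allVecs P n)

      #Ancestor-≤ : ∀ {s t} → S s → s ≢ x₀ → S t → t ≢ x₀ → #Ancestor s ℕ.≤ #Ancestor t
      #Ancestor-≤ {s} {t} Ss s≢ St t≢ =
        count-swap P (Ancestor? s) (Ancestor? t) s t (Ancestor-swap Ss s≢ St t≢)

      module _ {s : Fin n} (Ss : S s) (s≢x₀ : s ≢ x₀) where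

        -- The token ends in `B` exactly when its ancestor lies in `B`, and the ancestor is never
        -- `x₀`. Each remaining site of `B` is the ancestor equally often by `#Ancestor-≤` in both
        -- directions.
        #TopEnds-product : {B : Fin n → Set} (B? : Decidable B) → (∀ {x} → B x → S x) →
          (∀ {x z} → S x → Origin x z → (B x → B z) × (B z → B x)) →
          #TopEnds x₀ B? ≡ #without x₀ B? ℕ.* #Ancestor s
        #TopEnds-product {B} B? B⇒S B-origin = trans
          (count-cong (TopEnds? x₀ B?) (any-in Ancestor? sites) to from (allVecs P n))
          (trans (count-partition Ancestor? Ancestor-functional (allVecs P n) sites
                    (Unique.filter⁺ site? (Unique.allFin⁺ n)))
                 (sum-const #Ancestor (#Ancestor s) sites same))
          where
          site? : Decidable (λ x → B x × x ≢ x₀)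
          site? x = B? x ×-dec ¬? (x Fin.≟ x₀)
          sites = filter site? (allFin n)
          same : ∀ t → t ∈ sites → #Ancestor t ≡ #Ancestor s
          same t t∈ with proj₂ (∈-filter⁻ site? {xs = allFin n} t∈)
          ... | Bt , t≢ = ℕ.≤-antisym (#Ancestor-≤ (B⇒S Bt) t≢ Ss s≢x₀) (#Ancestor-≤ Ss s≢x₀ (B⇒S Bt) t≢)
          to : ∀ v → TopEnds x₀ B v → Any (λ t → Ancestor t v) sites
          to v ((lab , top) , q , q≡0 , Bq) = Any.map (λ { refl → h , refl })
            (∈-filter⁺ site? (∈-allFin (ancestor v h))
              (proj₁ (B-origin (B⇒S Bq) (proj₂ (origin lab N q (B⇒S Bq)))) Bq ,
               λ anc≡x₀ → q≢x₀ (origin-minimal lab x₀Min top N (ℕ.n≤1+n _) (B⇒S Bq) anc≡x₀)))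
            where
            h : TopEnds x₀ S v
            h = (lab , top) , q , q≡0 , B⇒S Bq
            q≢x₀ : q ≢ x₀
            -- At time `N` the element `x₀` still holds the largest original token, which by then is
            -- the label 1.
            q≢x₀ refl = ℕ.1+n≢n (trans (sym (token-minimal lab x₀Min top N (ℕ.n≤1+n _)))
                          (cong (λ k → suc (k + N)) q≡0))
          from : ∀ v → Any (λ t → Ancestor t v) sites → TopEnds x₀ B v
          from v any with find any
          ... | t , t∈ , ((lab , top) , q , q≡0 , Sq) , anc≡t =
            (lab , top) , q , q≡0 ,
              proj₂ (B-origin Sq (proj₂ (origin lab N q Sq)))
                (subst B (sym anc≡t) (proj₁ (proj₂ (∈-filter⁻ site? {xs = allFin n} t∈))))

        -- Applying the product formula to `T` and to `S` with the same factor `#Ancestor s` gives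
        -- the ratio, without having to know that factor.
        ratio-identity : #TopEnds x₀ T? ℕ.* #without x₀ S? ≡ #TopEnds x₀ S? ℕ.* #without x₀ T?
        ratio-identity = begin
          #TopEnds x₀ T? ℕ.* c              ≡⟨ cong (ℕ._* c) T-product ⟩
          b ℕ.* #Ancestor s ℕ.* c           ≡⟨ ℕ.*-comm (b ℕ.* #Ancestor s) c ⟩
          c ℕ.* (b ℕ.* #Ancestor s)         ≡⟨ cong (c ℕ.*_) (ℕ.*-comm b (#Ancestor s)) ⟩
          c ℕ.* (#Ancestor s ℕ.* b)         ≡⟨ ℕ.*-assoc c (#Ancestor s) b ⟨
          c ℕ.* #Ancestor s ℕ.* b           ≡⟨ cong (ℕ._* b) S-product ⟨
          #TopEnds x₀ S? ℕ.* b              ∎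
          where
          open ≡-Reasoning
          b = #without x₀ T?
          c = #without x₀ S?
          T-product : #TopEnds x₀ T? ≡ #without x₀ T? ℕ.* #Ancestor s
          T-product = #TopEnds-product T? T⇒S (λ _ → proj₂)
          S-product : #TopEnds x₀ S? ≡ #without x₀ S? ℕ.* #Ancestor s
          S-product = #TopEnds-product S? id (λ Sx (Sz , _) → (λ _ → Sz) , (λ _ → Sx))

-- Inflations of rooted trees

module Tree {m : ℕ} (Q : FinPoset m) (tree : IsRootedTreePoset Q) (reduced : IsReduced Q) where
  open Order Q

  _⋖?_ : ∀ x y → Dec (x ⋖ y)
  x ⋖? y = (x <? y) ×-dec Fin.all? (λ z → (x <? z) →-dec ¬? (z <? y))

  between? : ∀ x y → Dec (∃ λ z → x < z × z < y)
  between? x y = Fin.any? (λ z → (x <? z) ×-dec (z <? y))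

  cover-above : ∀ {x y} → x < y → ∃ λ c → x ⋖ c × c ≤ y
  cover-above {x} {y} = go (<-wellFounded y)
    where
    go : ∀ {y} → Acc _<_ y → x < y → ∃ λ c → x ⋖ c × c ≤ y
    go {y} (acc rs) x<y with between? x y
    ... | no none = y , (x<y , λ z x<z z<y → none (z , x<z , z<y)) , ≤-refl
    ... | yes (z , x<z , z<y) with go (rs z<y) x<z
    ...   | c , x⋖c , c≤z = c , x⋖c , ≤-trans c≤z (proj₁ z<y)

  cover-below : ∀ {x y} → x < y → ∃ λ c → x ≤ c × c ⋖ y
  cover-below {x} {y} = go (<-noetherian x)
    where
    go : ∀ {x} → Acc (flip _<_) x → x < y → ∃ λ c → x ≤ c × c ⋖ y
    go {x} (acc rs) x<y with between? x y
    ... | no none = x , ≤-refl , x<y , λ z x<z z<y → none (z , x<z , z<y)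
    ... | yes (z , x<z , z<y) with go (rs x<z) z<y
    ...   | c , z≤c , c⋖y = c , ≤-trans (proj₁ x<z) z≤c , c⋖y

  -- Two elements strictly above `x` are both weakly above its unique cover; the induction climbs to
  -- that cover.
  above-chain : ∀ {x y z} → x ≤ y → x ≤ z → y ≤ z ⊎ z ≤ y
  above-chain {x} = go (<-noetherian x)
    where
    go : ∀ {x y z} → Acc (flip _<_) x → x ≤ y → x ≤ z → y ≤ z ⊎ z ≤ y
    go (acc rs) x≤y x≤z with ≤⇒<∨≡ x≤y | ≤⇒<∨≡ x≤z
    ... | inj₂ refl | _         = inj₁ x≤z
    ... | inj₁ _    | inj₂ refl = inj₂ x≤y
    ... | inj₁ x<y  | inj₁ x<z with cover-above x<y | cover-above x<z
    ...   | c , x⋖c , c≤y | d , x⋖d , d≤z with proj₂ tree _ _ _ x⋖c x⋖d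
    ...     | refl = go (rs (proj₁ x⋖c)) c≤y d≤z

  -- Follow a zigzag path from `v`. A step up from below `v` ends at an element comparable with `v`,
  -- which is below `v` or, by maximality, equal to it.
  maximal-≥ : ∀ {v} → Maximal v → ∀ z → z ≤ v
  maximal-≥ {v} vMax z = go (proj₁ tree v z) ≤-refl
    where
    go : ∀ {a b} → Star (λ a b → a ≤ b ⊎ b ≤ a) a b → a ≤ v → b ≤ v
    go ε a≤v = a≤v
    go (inj₂ c≤a ◅ rest) a≤v = go rest (≤-trans c≤a a≤v)
    go (inj₁ a≤c ◅ rest) a≤v with above-chain a≤c a≤v
    ... | inj₁ c≤v = go rest c≤v
    ... | inj₂ v≤c with vMax _ v≤c
    ...   | refl = go rest ≤-refl

  -- This is where reducedness enters: it keeps the denominators nonzero, and it excludes descents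
  -- between different fibers.
  sibling : ∀ {w u} → w ⋖ u → ∃ λ w′ → w′ ⋖ u × w′ ≢ w
  sibling {w} {u} w⋖u with Fin.any? (λ w′ → (w′ ⋖? u) ×-dec ¬? (w′ Fin.≟ w))
  ... | yes found = found
  ... | no none = contradiction (w , w⋖u , only) (reduced u)
    where
    only : ∀ w′ → w′ ⋖ u → w′ ≡ w
    only w′ w′⋖u with w′ Fin.≟ w
    ... | yes eq = eq
    ... | no neq = contradiction (w′ , w′⋖u , neq) none

module Inflation {m N : ℕ} (Q : FinPoset m) (P : FinPoset (suc (suc N))) (φ : Fin (suc (suc N)) → Fin m)
  (tree : IsRootedTreePoset Q) (reduced : IsReduced Q) (inflation : IsInflation P Q φ) where
  private
    module P = Order P
    module Q = Order Q
    n = suc (suc N)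
  open Tree Q tree reduced
  open Promotion P
  open Ends P

  φ-< : ∀ {x y} → φ x ≢ φ y → x P.< y → φ x Q.< φ y
  φ-< {x} {y} φx≢φy = proj₁ (proj₂ (proj₂ inflation) x y φx≢φy)

  φ-reflects-< : ∀ {x y} → φ x Q.< φ y → x P.< y
  φ-reflects-< {x} {y} φx<φy = proj₂ (proj₂ (proj₂ inflation) x y (proj₂ φx<φy)) φx<φy

  φ-≤ : ∀ {x y} → x P.≤ y → φ x Q.≤ φ y
  φ-≤ {x} {y} x≤y with φ x Fin.≟ φ y
  ... | yes eq = subst (φ x Q.≤_) eq Q.≤-refl
  ... | no neq = proj₁ (φ-< neq (x≤y , neq ∘ cong φ))

  bottom : Fin m → Fin n
  bottom v = proj₁ (proj₁ (proj₂ inflation) v)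

  bottom-minimal : ∀ v → MinimalInFiber P Q φ v (bottom v)
  bottom-minimal v = proj₁ (proj₂ (proj₁ (proj₂ inflation) v))

  bottom-unique : ∀ v x → MinimalInFiber P Q φ v x → x ≡ bottom v
  bottom-unique v = proj₂ (proj₂ (proj₁ (proj₂ inflation) v))

  φ-bottom : ∀ v → φ (bottom v) ≡ v
  φ-bottom v = proj₁ (bottom-minimal v)

  -- Descending within the finite fiber ends at a minimal element of it, and there is only one.
  bottom-≤ : ∀ x → bottom (φ x) P.≤ x
  bottom-≤ x = go (P.<-wellFounded x) refl
    where
    go : ∀ {y} → Acc P._<_ y → φ y ≡ φ x → bottom (φ x) P.≤ y
    go {y} (acc rs) φy≡ with Fin.any? (λ z → (φ z Fin.≟ φ x) ×-dec (z P.<? y))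
    ... | yes (z , φz≡ , z<y) = P.≤-trans (go (rs z<y) φz≡) (proj₁ z<y)
    ... | no none = subst (P._≤ y) (bottom-unique (φ x) y (φy≡ , least)) P.≤-refl
      where
      least : ∀ z → φ z ≡ φ x → z P.≤ y → z ≡ y
      least z φz≡ z≤y with P.≤⇒<∨≡ z≤y
      ... | inj₁ z<y = contradiction (z , φz≡ , z<y) none
      ... | inj₂ eq  = eq

  bottom-Minimal : ∀ {ℓ} → Q.Minimal ℓ → P.Minimal (bottom ℓ)
  bottom-Minimal {ℓ} ℓMin y y≤ = proj₂ (bottom-minimal ℓ) y
    (ℓMin (φ y) (subst (φ y Q.≤_) (φ-bottom ℓ) (φ-≤ y≤))) y≤

  below? : ∀ v → Decidable (λ x → φ x Q.≤ v)
  below? v x = φ x Q.≤? v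

  strictlyBelow? : ∀ v → Decidable (λ x → φ x Q.< v)
  strictlyBelow? v x = φ x Q.<? v

  module Branch {ℓ w u} (ℓMin : Q.Minimal ℓ) (ℓ≤w : ℓ Q.≤ w) (w⋖u : w Q.⋖ u) where
    S T : Fin n → Set
    S x = φ x Q.< u
    T x = φ x Q.≤ w

    x₀ = bottom ℓ

    S-down : ∀ {x y} → y P.≤ x → S x → S y
    S-down y≤x = Q.≤-<-trans (φ-≤ y≤x)

    -- Both `u` and `φ y` are above `φ s`, hence comparable, and `φ y` is not strictly below `u`. So
    -- `u` is weakly below `φ y`.
    S-homogeneous : ∀ {s s′ y} → S s → S s′ → ¬ S y → s P.< y → s′ P.< y
    S-homogeneous {s} {s′} {y} Ss Ss′ ¬Sy s<y = φ-reflects-< (Q.<-≤-trans Ss′ u≤φy)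
      where
      u≤φy : u Q.≤ φ y
      u≤φy with above-chain (φ-≤ (proj₁ s<y)) (proj₁ Ss)
      ... | inj₂ u≤ = u≤
      ... | inj₁ φy≤u with Q.≤⇒<∨≡ φy≤u
      ...   | inj₁ Sy = contradiction Sy ¬Sy
      ...   | inj₂ eq = subst (u Q.≤_) (sym eq) Q.≤-refl

    S-exit : ∀ {s} → S s → ∃ λ y → s P.< y × ¬ S y
    S-exit {s} Ss = bottom u , φ-reflects-< (subst (φ s Q.<_) (sym (φ-bottom u)) Ss) ,
      λ { (_ , neq) → neq (φ-bottom u) }

    T-comparable : ∀ {x y} → x P.≤ y → S x → S y → (T x → T y) × (T y → T x)
    T-comparable {x} {y} x≤y Sx Sy = up , Q.≤-trans (φ-≤ x≤y)
      where
      up : T x → T y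
      up Tx with above-chain (φ-≤ x≤y) Tx
      ... | inj₁ Ty = Ty
      ... | inj₂ w≤φy with Q.≤⇒<∨≡ w≤φy
      ...   | inj₁ w<φy = contradiction Sy (proj₂ w⋖u (φ y) w<φy)
      ...   | inj₂ eq   = subst (Q._≤ w) eq Q.≤-refl

    T⇒S : ∀ {x} → T x → S x
    T⇒S Tx = Q.≤-<-trans Tx (proj₁ w⋖u)

    w′ = proj₁ (sibling w⋖u)
    w′⋖u = proj₁ (proj₂ (sibling w⋖u))
    w′≢w = proj₂ (proj₂ (sibling w⋖u))

    S-bottom : ∀ {v} → v Q.< u → S (bottom v)
    S-bottom {v} v<u = subst (Q._< u) (sym (φ-bottom v)) v<u

    -- If the sibling were `ℓ` itself, it would be strictly below `w` and could not be covered by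
    -- `u`. So `S` has a site other than `x₀`.
    bottom-sibling≢ : bottom w′ ≢ x₀
    bottom-sibling≢ eq with trans (sym (φ-bottom w′)) (trans (cong φ eq) (φ-bottom ℓ))
    ... | refl = proj₂ w′⋖u w (ℓ≤w , w′≢w) (proj₁ w⋖u)

    open Autonomy S T (strictlyBelow? u) S-down S-homogeneous S-exit T-comparable
    open Ratio (below? w) T⇒S x₀ (bottom-Minimal ℓMin)

    -- Otherwise S, with at least two elements, still holds original tokens only, but besides
    -- the label 0 there is just one of these left.
    ends-strictly-below : ∀ {L} → IsLabeling P L → ∀ {q} → toℕ (∂^ P N L q) ≡ 0 → φ q Q.≤ u → S q
    ends-strictly-below {L} lab {q} q≡0 φq≤u with Q.≤⇒<∨≡ φq≤u
    ... | inj₁ Sq = Sq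
    ... | inj₂ φq≡u = contradiction
          (trans (sym (φ-bottom w′)) (trans (cong φ same) (φ-bottom w))) w′≢w
      where
      ¬Sq : ¬ S q
      ¬Sq (_ , neq) = neq φq≡u
      labₙ = ∂^-labeling N L lab
      label-one : ∀ {v} → v Q.< u → toℕ (∂^ P N L (bottom v)) ≡ 1
      label-one {v} v<u = ℕ.≤-antisym
        (ℕ.s≤s⁻¹ (ℕ.+-cancelʳ-< N _ 2 (originals-above lab N (S-bottom (proj₁ w⋖u)) ¬Sq
          (φ-reflects-< (subst₂ Q._<_ (sym (φ-bottom w)) (sym φq≡u) (proj₁ w⋖u)))
          (subst (λ k → k + N ℕ.< n) (sym q≡0) (ℕ.n≤1+n _)) (bottom v) (S-bottom v<u))))
        (ℕ.n≢0⇒n>0 (λ z → ¬Sq (subst S (proj₁ labₙ _ _ (Fin.toℕ-injective (trans z (sym q≡0))))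
                                 (S-bottom v<u))))
      same : bottom w′ ≡ bottom w
      same = proj₁ labₙ _ _ (Fin.toℕ-injective
        (trans (label-one (proj₁ w′⋖u)) (sym (label-one (proj₁ w⋖u)))))

    -- Links consecutive factors: the event in the denominator at `u` is the event in the numerator
    -- one step further up the path.
    #TopEnds-strict : #TopEnds x₀ (below? u) ≡ #TopEnds x₀ (strictlyBelow? u)
    #TopEnds-strict = count-cong (TopEnds? x₀ (below? u)) (TopEnds? x₀ (strictlyBelow? u))
      (λ { v ((lab , top) , q , q≡0 , φq≤u) → (lab , top) , q , q≡0 , ends-strictly-below lab q≡0 φq≤u })
      (λ { v (t , q , q≡0 , φq<u) → t , q , q≡0 , proj₁ φq<u })
      (allVecs P n)

    cross : #TopEnds x₀ (below? w) ℕ.* #without x₀ (strictlyBelow? u)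
      ≡ #TopEnds x₀ (below? u) ℕ.* #without x₀ (below? w)
    cross = trans (ratio-identity (S-bottom (proj₁ w′⋖u)) bottom-sibling≢)
      (cong (ℕ._* #without x₀ (below? w)) (sym #TopEnds-strict))

    S-nonempty : #without x₀ (strictlyBelow? u) ≢ 0
    S-nonempty eq = ℕ.n≮0 (subst (0 ℕ.<_) eq (∈-length (∈-filter⁺ site? (∈-allFin (bottom w′))
      (S-bottom (proj₁ w′⋖u) , bottom-sibling≢))))
      where
      site? : Decidable (λ x → S x × x ≢ x₀)
      site? x = strictlyBelow? u x ×-dec ¬? (x Fin.≟ x₀)

  -- Fiber sizes and the product along a path to the root

  sum-fiberSize : {B : Fin m → Set} (B? : Decidable B) →
    sum (map (fiberSize P Q φ) (filter B? (allFin m))) ≡ count (λ x → B? (φ x)) (allFin n)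
  sum-fiberSize {B} B? = sym (trans
    (count-cong (λ x → B? (φ x)) (any-in fiber? vs)
      (λ x Bφx → Any.map (λ { refl → refl }) (∈-filter⁺ B? (∈-allFin (φ x)) Bφx))
      from (allFin n))
    (count-partition fiber? (λ _ _ _ r r′ → trans (sym r) r′) (allFin n) vs
      (Unique.filter⁺ B? (Unique.allFin⁺ m))))
    where
    fiber? : ∀ v → Decidable (λ x → φ x ≡ v)
    fiber? v x = φ x Fin.≟ v
    vs = filter B? (allFin m)
    from : ∀ x → Any (λ v → φ x ≡ v) vs → B (φ x)
    from x any with find any
    ... | v , v∈ , refl = proj₂ (∈-filter⁻ B? {xs = allFin m} v∈)

  #without-pred : {B : Fin n → Set} (B? : Decidable B) → ∀ x₀ → B x₀ →
    count B? (allFin n) ∸ 1 ≡ #without x₀ B?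
  #without-pred {B} B? x₀ Bx₀ = cong (_∸ 1) (trans
    (count-⊎ B? (Fin._≟ x₀) (λ x → B? x ×-dec ¬? (x Fin.≟ x₀)) split
      (λ { _ refl → Bx₀ }) (λ _ → proj₁) (λ { _ eq (_ , neq) → neq eq }) (allFin n))
    (cong (_+ #without x₀ B?)
      (count-single (Fin._≟ x₀) (allFin n) (Unique.allFin⁺ n) x₀ (∈-allFin x₀) refl (λ _ eq → eq))))
    where
    split : ∀ x → B x → x ≡ x₀ ⊎ B x × x ≢ x₀
    split x Bx with x Fin.≟ x₀
    ... | yes eq = inj₁ eq
    ... | no neq = inj₂ (Bx , neq)

  leafCount : Fin m → Fin m → ℕ
  leafCount ℓ v = #TopEnds (bottom ℓ) (below? v)

  -- At the root the condition on where the token ends is vacuous, so only the position of the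
  -- largest label is prescribed.
  leafCount-root : ∀ ℓ {v} → Q.Maximal v → leafCount ℓ v ≡ suc N !
  leafCount-root ℓ {v} vMax = trans
    (count-cong (TopEnds? (bottom ℓ) (below? v)) (TopAt? P (bottom ℓ)) (λ _ → proj₁) to (allVecs P n))
    (count-TopAt P (bottom ℓ))
    where
    to : ∀ L → TopAt P (bottom ℓ) L → TopEnds (bottom ℓ) (λ x → φ x Q.≤ v) L
    to L t@(lab , _) with labelOne-spec _ (∂^-labeling N (lookup L) lab) Fin.zero
    ... | q , _ , q≡0 = t , q , q≡0 , maximal-≥ vMax (φ q)

  module _ {ℓ} (ℓMin : Q.Minimal ℓ) where

    leafCount-step : ∀ {w u} → ℓ Q.≤ w → w Q.⋖ u →
      (+ leafCount ℓ w) / 1 ≡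
        ratio P Q φ (sizeBelowEq P Q φ w ∸ 1) (sizeBelow P Q φ u ∸ 1) ℚ.* ((+ leafCount ℓ u) / 1)
    leafCount-step {w} {u} ℓ≤w w⋖u = convert _ _
      (trans (cong (_∸ 1) (sum-fiberSize (Q._≤? w)))
        (#without-pred (below? w) (bottom ℓ) (subst (Q._≤ w) (sym (φ-bottom ℓ)) ℓ≤w)))
      (trans (cong (_∸ 1) (sum-fiberSize (Q._<? u)))
        (#without-pred (strictlyBelow? u) (bottom ℓ)
          (subst (Q._< u) (sym (φ-bottom ℓ)) (Q.≤-<-trans ℓ≤w (proj₁ w⋖u)))))
      where
      open Branch ℓMin ℓ≤w w⋖u using (cross; S-nonempty)
      convert : ∀ b c → b ≡ #without (bottom ℓ) (below? w) → c ≡ #without (bottom ℓ) (strictlyBelow? u) →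
        (+ leafCount ℓ w) / 1 ≡ ratio P Q φ b c ℚ.* ((+ leafCount ℓ u) / 1)
      -- The default value of `ratio` at denominator 0 never occurs, because `S` has an element
      -- besides `x₀`.
      convert b zero    b≡ c≡ = contradiction (sym c≡) S-nonempty
      convert b (suc c) b≡ c≡ = /1-cross (leafCount ℓ w) b c (leafCount ℓ u)
        (trans (cong (leafCount ℓ w ℕ.*_) c≡) (trans cross (cong (leafCount ℓ u ℕ.*_) (sym b≡))))

    leafCount-path : ∀ v us → ℓ Q.≤ v → HassePathToRoot Q v us →
      (+ leafCount ℓ v) / 1 ≡ (+ (suc N !)) / 1 ℚ.* pathProduct P Q φ v us
    leafCount-path v [] _ vMax = trans (cong (λ k → (+ k) / 1) (leafCount-root ℓ vMax)) (sym (ℚ.*-identityʳ _))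
    leafCount-path v (u ∷ us) ℓ≤v (v⋖u , rest) = begin
      (+ leafCount ℓ v) / 1              ≡⟨ leafCount-step ℓ≤v v⋖u ⟩
      r ℚ.* ((+ leafCount ℓ u) / 1)      ≡⟨ cong (r ℚ.*_) (leafCount-path u us ℓ≤u rest) ⟩
      r ℚ.* (F ℚ.* p)                    ≡⟨ ℚ.*-assoc r F p ⟨
      r ℚ.* F ℚ.* p                      ≡⟨ cong (ℚ._* p) (ℚ.*-comm r F) ⟩
      F ℚ.* r ℚ.* p                      ≡⟨ ℚ.*-assoc F r p ⟩
      F ℚ.* (r ℚ.* p)                    ∎
      where
      open ≡-Reasoning
      ℓ≤u = Q.≤-trans ℓ≤v (proj₁ (proj₁ v⋖u))
      F = (+ (suc N !)) / 1
      r = ratio P Q φ (sizeBelowEq P Q φ v ∸ 1) (sizeBelow P Q φ u ∸ 1)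
      p = pathProduct P Q φ u us

  leafCount-sum : (path : Fin m → List (Fin m)) →
    (∀ ℓ → Q.Minimal ℓ → HassePathToRoot Q ℓ (path ℓ)) → ∀ ℓs → (∀ ℓ → ℓ ∈ ℓs → Q.Minimal ℓ) →
    (+ sum (map (λ ℓ → leafCount ℓ ℓ) ℓs)) / 1 ≡
      (+ (suc N !)) / 1 ℚ.* foldr (λ ℓ acc → pathProduct P Q φ ℓ (path ℓ) ℚ.+ acc) ℚ.0ℚ ℓs
  leafCount-sum path toRoot [] _ = sym (ℚ.*-zeroʳ ((+ (suc N !)) / 1))
  leafCount-sum path toRoot (ℓ ∷ ℓs) minimal =
    trans (/1-homo-+ (leafCount ℓ ℓ) _)
    (trans (cong₂ ℚ._+_ (leafCount-path ℓMin ℓ (path ℓ) Q.≤-refl (toRoot ℓ ℓMin))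
                        (leafCount-sum path toRoot ℓs (λ k → minimal k ∘ there)))
           (sym (ℚ.*-distribˡ-+ ((+ (suc N !)) / 1) _ _)))
    where ℓMin = minimal ℓ (here refl)

  -- Tangled labelings in terms of leaves

  -- Carrying label 0 makes an element a basin, and basins persist. A minimal element that is not a
  -- basin has thus never carried 0, and its token has not moved.
  never-Basin : ∀ {L} → IsLabeling P L → ∀ {x} → P.Minimal x → ∀ t → ¬ Basin (∂^ P t L) x →
    token L t x ≡ toℕ (L x)
  never-Basin lab xMin zero _ = ℕ.+-identityʳ _
  never-Basin {L} lab {x} xMin (suc t) ¬basin = trans (token-suc L t x)
    (trans (cong (_+ t) (step-minimal labₜ xMin (¬basinₜ ∘ zero-Basin labₜ)))
           (never-Basin lab xMin t ¬basinₜ))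
    where
    labₜ = ∂^-labeling t L lab
    ¬basinₜ : ¬ Basin (∂^ P t L) x
    ¬basinₜ = ¬basin ∘ ∂-Basin labₜ

  LeafEnds : Labeling n → Fin m → Set
  LeafEnds L ℓ = suc (toℕ (L (bottom ℓ))) ≡ n × EndsIn (λ x → φ x Q.≤ ℓ) L

  -- A descent from `x` to `q` after `N` promotions can only involve the labels 1 and 0. Since `q`
  -- has label 0, every element below `q` gives such a descent, so `x` is the only one.
  tangled⇒LeafEnds : ∀ {L} → IsLabeling P L → Tangled P L → ∃ λ ℓ → Q.Minimal ℓ × LeafEnds L ℓ
  tangled⇒LeafEnds {L} lab (_ , ¬ext)
    with Fin.any? (λ x → Fin.any? (λ y → (x P.≤? y) ×-dec (toℕ (∂^ P N L y) ℕ.<? toℕ (∂^ P N L x))))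
  ... | no none = contradiction (∂^-labeling N L lab ,
          (λ x y x≤y → ℕ.≮⇒≥ (λ y<x → none (x , y , x≤y , y<x)))) ¬ext
  ... | yes (x , q , x≤q , Mq<Mx) = φ x , ℓMin , top , q , q≡0 , subst (Q._≤ φ x) (sym φq≡φx) Q.≤-refl
    where
    M = ∂^ P N L
    inj = proj₁ (∂^-labeling N L lab)
    x<q : x P.< q
    x<q = x≤q , λ { refl → ℕ.<-irrefl refl Mq<Mx }
    -- As `n` is `N + 2`, a label of at least 2 at time `N` is a token of at least `n`, to which
    -- `frozen` applies.
    old : ∀ {z} → toℕ (M z) ℕ.< 2 ⊎ n ℕ.≤ token L N z
    old {z} with toℕ (M z) ℕ.<? 2
    ... | yes lt = inj₁ lt
    ... | no ≥2  = inj₂ (ℕ.+-monoˡ-≤ N (ℕ.≮⇒≥ ≥2))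
    descent⇒old : ∀ {z y} → z P.< y → toℕ (M y) ℕ.≤ toℕ (M z) → toℕ (M z) ℕ.< 2
    descent⇒old {z} {y} z<y My≤Mz with old {z}
    ... | inj₁ lt = lt
    ... | inj₂ n≤ = contradiction (ℕ.+-monoˡ-≤ N My≤Mz) (ℕ.<⇒≱ (frozen lab N z<y n≤))
    x≡1 : toℕ (M x) ≡ 1
    x≡1 = ℕ.≤-antisym (ℕ.s≤s⁻¹ (descent⇒old x<q (ℕ.<⇒≤ Mq<Mx))) (ℕ.≤-<-trans z≤n Mq<Mx)
    q≡0 : toℕ (M q) ≡ 0
    q≡0 = ℕ.n<1⇒n≡0 (subst (toℕ (M q) ℕ.<_) x≡1 Mq<Mx)
    small : ∀ z → toℕ (M z) ℕ.< 2 → z ≡ x ⊎ z ≡ q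
    small z lt with toℕ (M z) in eq
    ... | 0 = inj₂ (inj _ _ (Fin.toℕ-injective (trans eq (sym q≡0))))
    ... | 1 = inj₁ (inj _ _ (Fin.toℕ-injective (trans eq (sym x≡1))))
    small z (s≤s (s≤s ())) | suc (suc _)
    below-q : ∀ z → z P.< q → z ≡ x
    below-q z z<q with small z (descent⇒old z<q (subst (ℕ._≤ _) (sym q≡0) z≤n))
    ... | inj₁ eq   = eq
    ... | inj₂ refl = contradiction refl (proj₂ z<q)
    xMin : P.Minimal x
    xMin z z≤x = below-q z (P.≤-<-trans z≤x x<q)
    -- Otherwise `φ q` covers two different vertices, and the bottoms of both fibers would be below
    -- `q`, where only `x` is.
    φq≡φx : φ q ≡ φ x
    φq≡φx with φ x Fin.≟ φ q
    ... | yes eq = sym eq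
    ... | no neq with cover-below (φ-< neq x<q)
    ...   | w , _ , w⋖φq with sibling w⋖φq
    ...     | w′ , w′⋖φq , w′≢w = contradiction (trans (under w′⋖φq) (sym (under w⋖φq))) w′≢w
      where
      under : ∀ {v} → v Q.⋖ φ q → v ≡ φ x
      under {v} (v<φq , _) = trans (sym (φ-bottom v))
        (cong φ (below-q (bottom v) (φ-reflects-< (subst (Q._< φ q) (sym (φ-bottom v)) v<φq))))
    ℓMin : Q.Minimal (φ x)
    ℓMin v v≤ with Q.≤⇒<∨≡ v≤
    ... | inj₂ eq   = eq
    ... | inj₁ v<φx = trans (sym (φ-bottom v))
          (cong φ (xMin (bottom v) (proj₁ (φ-reflects-< (subst (Q._< φ x) (sym (φ-bottom v)) v<φx)))))
    x≡bottom : x ≡ bottom (φ x)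
    x≡bottom = bottom-unique (φ x) x (refl , λ y _ → xMin y)
    -- The smaller label at `q` shows that `x` is not a basin, so its token is the original label,
    -- namely `1 + N`.
    top : suc (toℕ (L (bottom (φ x)))) ≡ n
    top = trans (cong (suc ∘ toℕ ∘ L) (sym x≡bottom)) (cong suc
      (trans (sym (never-Basin lab xMin N (λ basin → ℕ.<-asym Mq<Mx (basin q x<q)))) (cong (_+ N) x≡1)))

  -- After `N` promotions `bottom ℓ` carries 1 while `q`, in the same fiber and hence above it,
  -- carries 0.
  LeafEnds⇒tangled : ∀ {L} → IsLabeling P L → ∀ {ℓ} → Q.Minimal ℓ → LeafEnds L ℓ → Tangled P L
  LeafEnds⇒tangled {L} lab {ℓ} ℓMin (top , q , q≡0 , φq≤ℓ) = s≤s (s≤s z≤n) , λ (_ , monotone) →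
    ℕ.1+n≢0 (trans (sym bottom≡1) (ℕ.n≤0⇒n≡0 (subst (_ ℕ.≤_) q≡0 (monotone (bottom ℓ) q bottom≤q))))
    where
    bottom≤q : bottom ℓ P.≤ q
    bottom≤q = subst (λ v → bottom v P.≤ q) (ℓMin (φ q) φq≤ℓ) (bottom-≤ q)
    bottom≡1 : toℕ (∂^ P N L (bottom ℓ)) ≡ 1
    bottom≡1 = ℕ.+-cancelʳ-≡ N _ 1
      (ℕ.suc-injective (token-minimal lab (bottom-Minimal ℓMin) top N (ℕ.n≤1+n _)))

  -- The leaf is determined by the position of the largest label, so the sets counted for different
  -- leaves are disjoint.
  numTangled-sum : numTangled P ≡ sum (map (λ ℓ → leafCount ℓ ℓ) (leaves Q))
  numTangled-sum = trans
    (count-cong (λ v → isLabeling? P (lookup v) ×-dec tangled? P (lookup v))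
      (any-in ends? (leaves Q)) to from (allVecs P n))
    (count-partition ends? functional (allVecs P n) (leaves Q) (Unique.filter⁺ Q.minimal? (Unique.allFin⁺ m)))
    where
    ends? : ∀ ℓ → Decidable (TopEnds (bottom ℓ) (λ x → φ x Q.≤ ℓ))
    ends? ℓ = TopEnds? (bottom ℓ) (below? ℓ)
    functional : ∀ ℓ k v → TopEnds (bottom ℓ) (λ x → φ x Q.≤ ℓ) v →
      TopEnds (bottom k) (λ x → φ x Q.≤ k) v → ℓ ≡ k
    functional ℓ k v ((lab , top) , _) ((_ , top′) , _) = trans (sym (φ-bottom ℓ)) (trans (cong φ
      (proj₁ lab _ _ (Fin.toℕ-injective (ℕ.suc-injective (trans top (sym top′)))))) (φ-bottom k))
    to : ∀ v → IsLabeling P (lookup v) × Tangled P (lookup v) →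
      Any (λ ℓ → TopEnds (bottom ℓ) (λ x → φ x Q.≤ ℓ) v) (leaves Q)
    to v (lab , tangled) with tangled⇒LeafEnds lab tangled
    ... | ℓ , ℓMin , top , ends = Any.map (λ { refl → (lab , top) , ends })
            (∈-filter⁺ Q.minimal? (∈-allFin ℓ) ℓMin)
    from : ∀ v → Any (λ ℓ → TopEnds (bottom ℓ) (λ x → φ x Q.≤ ℓ) v) (leaves Q) →
      IsLabeling P (lookup v) × Tangled P (lookup v)
    from v any with find any
    ... | ℓ , ℓ∈ , (lab , top) , ends =
      lab , LeafEnds⇒tangled lab (proj₂ (∈-filter⁻ Q.minimal? {xs = allFin m} ℓ∈)) (top , ends)

open import Data.Nat using (_≤_)
open import Data.Rational using (_*_)

theorem3p5 : {m n : ℕ} (Q : FinPoset m) (P : FinPoset n) (φ : Fin n → Fin m) →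
    IsRootedTreePoset Q → IsReduced Q → IsInflation P Q φ → 2 ≤ n →
    (path : Fin m → List (Fin m)) →
    (∀ ℓ → FinPoset.Minimal Q ℓ → HassePathToRoot Q ℓ (path ℓ)) →
    (+ numTangled P) / 1 ≡ ((+ ((n ∸ 1) !)) / 1) * leafSum P Q φ path
theorem3p5 {m} Q P φ tree reduced inflation (s≤s (s≤s z≤n)) path toRoot =
  trans (cong (λ k → (+ k) / 1) numTangled-sum)
    (leafCount-sum path toRoot (leaves Q)
      (λ ℓ ℓ∈ → proj₂ (∈-filter⁻ (FinPoset.minimal? Q) {xs = allFin m} ℓ∈)))
  where open Inflation Q P φ tree reduced inflation
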